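{- There exists a sequence $(G_n)_{n\in\mathbb N}$ of directed acyclic graphs with uniformly bounded degrees (i.e. $\sup_n \max_{v\in V(G_n)} \deg(v;G_n)<\infty$) which is an $(n^{\delta})$-extender sequence, with $\delta\approx 0.019$; that is, $\lim_{n\to\infty}|V(G_n)|=\infty$ and there exist $\varepsilon>0$ and $C>0$ such that for every $n\in\mathbb N$ the graph $G_n$ is an $(\varepsilon, C\cdot |V(G_n)|^{\delta})$-extender.
   Context: A graph is a pair $G=(V,E)$ with $V$ a non-empty finite set and $E\subset V\times V$ disjoint from the diagonal; elements of $E$ are directed edges. The degree $\deg(v;G)$ is the in-degree plus the out-degree of $v$. A directed simple path of length $D\ge 0$ is a tuple $(x_0,\ldots,x_D)$ of pairwise distinct vertices with $(x_i,x_{i+1})\in E$ for all $i<D$. A directed acyclic graph (dag) is a graph with no directed cycles. For a proper subset $S\subsetneq V(G)$, $\operatorname{codepth}(S;G)\in\mathbb N$ is the maximal $D$ such that there exists a directed simple path $(x_0,\ldots,x_D)$ in $G$ disjoint from $S$. For $\varepsilon,\rho>0$, a dag $G$ is an $(\varepsilon,\rho)$-extender if for every $S\subsetneq V(G)$ with $|S|\le \varepsilon|V(G)|$ we have $\operatorname{codepth}(S;G)\ge\rho$. For a sequence $(\rho_n)$ of positive reals with $\rho_n\to\infty$, a sequence $(G_n)$ of dags with uniformly bounded in-degrees is a $(\rho_n)$-extender sequence if $|V(G_n)|\to\infty$ and there exist $\varepsilon>0$, $C>0$ such that for all $n$, $G_n$ is an $(\varepsilon, C\rho_{|V(G_n)|})$-extender.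 -}

module Defs where

open import Algebra.Bundles using (CommutativeRing)
import Algebra.Properties.Semiring.Exp as Exp
open import Data.Fin using (Fin)
import Data.Fin.Properties as Fin
open import Data.Fin.Subset using (Subset; _∉_; _⊂_; ⊤; ∣_∣)
open import Data.Fin.Subset.Properties using (_∈?_)
open import Data.Integer as ℤ using (+_; +[1+_])
open import Data.Nat as ℕ using (ℕ; zero; suc; z≤n; s≤s)
open import Data.Nat.Coprimality using (1-coprimeTo) renaming (sym to coprime-sym)
import Data.Nat.Properties as ℕ
open import Data.Product using (∃; ∃-syntax; _×_; _,_; proj₁; proj₂)
open import Data.Rational as ℚ
  using (ℚ; mkℚ; 0ℚ; 1ℚ; ½; _/_; ↥_; ↧ₙ_; Positive; NonNegative)
import Data.Rational.Properties as ℚ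
open import Data.Sum using (inj₁; inj₂)
open import Data.Vec using (Vec; []; _∷_; head; last; count; allFin)
open import Data.Vec.Relation.Unary.All using (All; []; _∷_; all?)
open import Data.Vec.Relation.Unary.AllPairs using ([]; _∷_; allPairs?)
open import Data.Vec.Relation.Unary.Linked using (Linked; [-]; linked?)
open import Data.Vec.Relation.Unary.Unique.Propositional using (Unique)
open import Data.Vec.Relation.Unary.Unique.Propositional.Properties using (lookup-injective)
open import Level using (0ℓ)
open import Relation.Binary using (Rel; Decidable)
open import Relation.Binary.PropositionalEquality
  using (_≡_; refl; sym; trans; cong; subst)
open import Relation.Nullary using (Dec; yes; no; ¬_; ¬?)
open import Relation.Nullary.Decidable using (map′; _×-dec_)
import Relation.Unary as U

-- Rational powers with exponent in ℕ: x ^ 0 = 1, x ^ suc k = x * x ^ k.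

open Exp (CommutativeRing.semiring ℚ.+-*-commutativeRing) public
  using (_^_; ^-assocʳ)


*-pos : ∀ {p q} → 0ℚ ℚ.< p → 0ℚ ℚ.< q → 0ℚ ℚ.< p ℚ.* q
*-pos {p} {q} 0<p 0<q =
  ℚ.positive⁻¹ (p ℚ.* q) {{ℚ.pos*pos⇒pos p {{ℚ.positive 0<p}} q {{ℚ.positive 0<q}}}}

*-mono-< : ∀ {a b c d} → 0ℚ ℚ.< b → 0ℚ ℚ.< c → a ℚ.< b → c ℚ.< d → a ℚ.* c ℚ.< b ℚ.* d
*-mono-< {a} {b} {c} {d} 0<b 0<c a<b c<d =
  ℚ.<-trans (ℚ.*-monoˡ-<-pos c {{ℚ.positive 0<c}} a<b)
            (ℚ.*-monoʳ-<-pos b {{ℚ.positive 0<b}} c<d)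

*-mono-≤ : ∀ {a b c d} → 0ℚ ℚ.≤ b → 0ℚ ℚ.≤ c → a ℚ.≤ b → c ℚ.≤ d → a ℚ.* c ℚ.≤ b ℚ.* d
*-mono-≤ {a} {b} {c} {d} 0≤b 0≤c a≤b c≤d =
  ℚ.≤-trans (ℚ.*-monoʳ-≤-nonNeg c {{ℚ.nonNegative 0≤c}} a≤b)
            (ℚ.*-monoˡ-≤-nonNeg b {{ℚ.nonNegative 0≤b}} c≤d)

0<1 : 0ℚ ℚ.< 1ℚ
0<1 = ℚ.positive⁻¹ 1ℚ

^-pos : ∀ {x} k → 0ℚ ℚ.< x → 0ℚ ℚ.< x ^ k
^-pos zero    0<x = 0<1
^-pos (suc k) 0<x = *-pos 0<x (^-pos k 0<x)

^-monoˡ-≤ : ∀ {x y} k → 0ℚ ℚ.< x → x ℚ.≤ y → x ^ k ℚ.≤ y ^ k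
^-monoˡ-≤ zero    0<x x≤y = ℚ.≤-refl
^-monoˡ-≤ (suc k) 0<x x≤y =
  *-mono-≤ (ℚ.<⇒≤ (ℚ.<-≤-trans 0<x x≤y)) (ℚ.<⇒≤ (^-pos k 0<x)) x≤y (^-monoˡ-≤ k 0<x x≤y)

1≤^ : ∀ {x} k → 1ℚ ℚ.≤ x → 1ℚ ℚ.≤ x ^ k
1≤^ zero    1≤x = ℚ.≤-refl
1≤^ {x} (suc k) 1≤x =
  *-mono-≤ {1ℚ} {x} {1ℚ} (ℚ.<⇒≤ (ℚ.<-≤-trans 0<1 1≤x)) (ℚ.<⇒≤ 0<1) 1≤x (1≤^ k 1≤x)

^-monoʳ-≤ : ∀ {x m n} → 1ℚ ℚ.≤ x → m ℕ.≤ n → x ^ m ℚ.≤ x ^ n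
^-monoʳ-≤ {n = n} 1≤x z≤n = 1≤^ n 1≤x
^-monoʳ-≤ {x} {suc m} {suc n} 1≤x (s≤s m≤n) =
  ℚ.*-monoˡ-≤-nonNeg x {{ℚ.nonNegative (ℚ.<⇒≤ (ℚ.<-≤-trans 0<1 1≤x))}} (^-monoʳ-≤ 1≤x m≤n)

^-<1 : ∀ {x} k → 0ℚ ℚ.< x → x ℚ.< 1ℚ → x ^ suc k ℚ.< 1ℚ
^-<1 {x} zero    0<x x<1 = subst (ℚ._< 1ℚ) (sym (ℚ.*-identityʳ x)) x<1
^-<1 {x} (suc k) 0<x x<1 =
  *-mono-< {x} {1ℚ} 0<1 (^-pos (suc k) 0<x) x<1 (^-<1 k 0<x x<1)

*-openʳ : ∀ {r x c} → 0ℚ ℚ.< r → r ℚ.* x ℚ.< c → ∃[ y ] x ℚ.< y × r ℚ.* y ℚ.< c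
*-openʳ {r} {x} {c} 0<r rx<c = widen (ℚ.<-dense rx<c)
  where
  instance
    r-pos : Positive r
    r-pos = ℚ.positive 0<r
    r-nonZero : ℚ.NonZero r
    r-nonZero = ℚ.pos⇒nonZero r
    r-nonNeg : NonNegative r
    r-nonNeg = ℚ.pos⇒nonNeg r
  widen : (∃[ m ] r ℚ.* x ℚ.< m × m ℚ.< c) → ∃[ y ] x ℚ.< y × r ℚ.* y ℚ.< c
  widen (m , rx<m , m<c) =
    ℚ.1/ r ℚ.* m
    , ℚ.*-cancelˡ-<-nonNeg r (subst (r ℚ.* x ℚ.<_) (sym r*m/r≡m) rx<m)
    , subst (ℚ._< c) (sym r*m/r≡m) m<c
    where
    r*m/r≡m : r ℚ.* (ℚ.1/ r ℚ.* m) ≡ m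
    r*m/r≡m = trans (sym (ℚ.*-assoc r (ℚ.1/ r) m))
                (trans (cong (ℚ._* m) (ℚ.*-inverseʳ r)) (ℚ.*-identityˡ m))

*-open : ∀ {r x c} → 0ℚ ℚ.< r → 0ℚ ℚ.< x → r ℚ.* x ℚ.< c →
         ∃[ s ] ∃[ y ] r ℚ.< s × x ℚ.< y × s ℚ.* y ℚ.< c
*-open {r} {x} {c} 0<r 0<x rx<c with *-openʳ 0<r rx<c
... | y , x<y , ry<c with *-openʳ (ℚ.<-trans 0<x x<y) (subst (ℚ._< c) (ℚ.*-comm r y) ry<c)
... | s , r<s , ys<c = s , y , r<s , x<y , subst (ℚ._< c) (ℚ.*-comm y s) ys<c

⊓-^-≤ : ∀ {r s t m} k → 0ℚ ℚ.< r → r ℚ.< s → r ℚ.< t → t ^ k ℚ.< m →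
        r ℚ.< s ℚ.⊓ t × (s ℚ.⊓ t) ^ suc k ℚ.≤ s ℚ.* m
⊓-^-≤ {r} {s} {t} {m} k 0<r r<s r<t tᵏ<m = r<s⊓t ,
  *-mono-≤ (ℚ.<⇒≤ (ℚ.<-trans 0<r r<s)) (ℚ.<⇒≤ (^-pos k 0<s⊓t)) (ℚ.p⊓q≤p s t)
    (ℚ.≤-trans (^-monoˡ-≤ k 0<s⊓t (ℚ.p⊓q≤q s t)) (ℚ.<⇒≤ tᵏ<m))
  where
  r<s⊓t : r ℚ.< s ℚ.⊓ t
  r<s⊓t with ℚ.⊓-sel s t
  ... | inj₁ eq = subst (r ℚ.<_) (sym eq) r<s
  ... | inj₂ eq = subst (r ℚ.<_) (sym eq) r<t
  0<s⊓t : 0ℚ ℚ.< s ℚ.⊓ t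
  0<s⊓t = ℚ.<-trans 0<r r<s⊓t

^-open : ∀ {r c} k → 0ℚ ℚ.< r → r ^ k ℚ.< c → ∃[ s ] r ℚ.< s × s ^ k ℚ.< c
^-open {r} zero 0<r 1<c =
  r ℚ.+ 1ℚ
  , subst (ℚ._< r ℚ.+ 1ℚ) (ℚ.+-identityʳ r) (ℚ.+-monoʳ-< r 0<1)
  , 1<c
^-open {r} {c} (suc k) 0<r r*rᵏ<c = step (*-open 0<r (^-pos k 0<r) r*rᵏ<c)
  where
  step : (∃[ s ] ∃[ m ] r ℚ.< s × r ^ k ℚ.< m × s ℚ.* m ℚ.< c) →
         ∃[ s ] r ℚ.< s × s ^ suc k ℚ.< c
  step (s , m , r<s , rᵏ<m , sm<c) =
    let t , r<t , tᵏ<m = ^-open k 0<r rᵏ<m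
        r<s⊓t , ≤sm    = ⊓-^-≤ k 0<r r<s r<t tᵏ<m
    in s ℚ.⊓ t , r<s⊓t , ℚ.≤-<-trans ≤sm sm<c

1≤n/1 : ∀ n .{{_ : ℕ.NonZero n}} → 1ℚ ℚ.≤ + n / 1
1≤n/1 (suc n) =
  subst (1ℚ ℚ.≤_) (sym (ℚ.↥p/↧p≡p (mkℚ +[1+ n ] 0 (coprime-sym (1-coprimeTo (suc n))))))
    (ℚ.*≤* (ℤ.+≤+ (s≤s z≤n)))

0<n/1 : ∀ n .{{_ : ℕ.NonZero n}} → 0ℚ ℚ.< + n / 1
0<n/1 n = ℚ.<-≤-trans 0<1 (1≤n/1 n)

-- Positive reals, as lower Dedekind cuts in the positive rationals
-- (q ∈ℝ x means 0 < q < x).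

record ℝ⁺ : Set₁ where
  infix 4 _∋_
  field
    _∋_       : ℚ → Set
    positive  : ∀ {q} → _∋_ q → 0ℚ ℚ.< q
    downward  : ∀ {p q} → 0ℚ ℚ.< p → p ℚ.< q → _∋_ q → _∋_ p
    open-cut  : ∀ {q} → _∋_ q → ∃[ r ] q ℚ.< r × _∋_ r
    inhabited : ∃[ q ] _∋_ q
    bounded   : ∃[ b ] (∀ {q} → _∋_ q → q ℚ.< b)

infix 4 _∈ℝ_ _ℚ≤ℝ_ _ℝ≤ℚ_
infixl 7 _*ℝ_
infixr 8 _^ℝ_

_∈ℝ_ : ℚ → ℝ⁺ → Set
q ∈ℝ x = ℝ⁺._∋_ x q

_ℚ≤ℝ_ : ℚ → ℝ⁺ → Set
q ℚ≤ℝ x = ∀ {p} → 0ℚ ℚ.< p → p ℚ.< q → p ∈ℝ x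

_ℝ≤ℚ_ : ℝ⁺ → ℚ → Set
x ℝ≤ℚ q = ∀ {p} → p ∈ℝ x → p ℚ.≤ q

fromℚ : (q : ℚ) .{{_ : Positive q}} → ℝ⁺
fromℚ q = record
  { _∋_       = λ p → 0ℚ ℚ.< p × p ℚ.< q
  ; positive  = proj₁
  ; downward  = λ 0<p p<r r∈ → 0<p , ℚ.<-trans p<r (proj₂ r∈)
  ; open-cut  = λ (0<p , p<q) → let r , p<r , r<q = ℚ.<-dense p<q in
                  r , p<r , ℚ.<-trans 0<p p<r , r<q
  ; inhabited = ℚ.<-dense (ℚ.positive⁻¹ q)
  ; bounded   = q , proj₂
  }

fromℕ : (n : ℕ) .{{_ : ℕ.NonZero n}} → ℝ⁺
fromℕ n = fromℚ (+ n / 1) {{ℚ.positive (0<n/1 n)}}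

_*ℝ_ : ℝ⁺ → ℝ⁺ → ℝ⁺
x *ℝ y = record
  { _∋_       = λ q → 0ℚ ℚ.< q × ∃[ a ] ∃[ b ] a ∈ℝ x × b ∈ℝ y × q ℚ.< a ℚ.* b
  ; positive  = proj₁
  ; downward  = λ 0<p p<q (_ , a , b , a∈x , b∈y , q<ab) →
                  0<p , a , b , a∈x , b∈y , ℚ.<-trans p<q q<ab
  ; open-cut  = λ (0<q , a , b , a∈x , b∈y , q<ab) →
                  let r , q<r , r<ab = ℚ.<-dense q<ab in
                  r , q<r , ℚ.<-trans 0<q q<r , a , b , a∈x , b∈y , r<ab
  ; inhabited = let a , a∈x = X.inhabited
                    b , b∈y = Y.inhabited
                    q , 0<q , q<ab = ℚ.<-dense (*-pos (X.positive a∈x) (Y.positive b∈y))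
                in q , 0<q , a , b , a∈x , b∈y , q<ab
  ; bounded   = let A , x<A = X.bounded
                    B , y<B = Y.bounded
                in A ℚ.* B , λ (_ , a , b , a∈x , b∈y , q<ab) →
                  ℚ.<-trans q<ab
                    (*-mono-< (ℚ.<-trans (X.positive a∈x) (x<A a∈x)) (Y.positive b∈y)
                      (x<A a∈x) (y<B b∈y))
  }
  where
  module X = ℝ⁺ x
  module Y = ℝ⁺ y

numerator-bound : ∀ {s b} → 0ℚ ℚ.< s → s ℚ.< b → ℤ.∣ ↥ s ∣ ℕ.≤ ℤ.∣ ↥ b ∣ ℕ.* ↧ₙ s
numerator-bound {s} {b} 0<s s<b =
  bound s b {{ℚ.positive 0<s}} {{ℚ.positive (ℚ.<-trans 0<s s<b)}} s<b
  where
  bound : ∀ s b .{{_ : Positive s}} .{{_ : Positive b}} → s ℚ.< b →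
          ℤ.∣ ↥ s ∣ ℕ.≤ ℤ.∣ ↥ b ∣ ℕ.* ↧ₙ s
  bound s@(mkℚ +[1+ p ] d _) b@(mkℚ +[1+ n ] e _) (ℚ.*<* (ℤ.+<+ p*e<n*d)) =
    ℕ.≤-trans (ℕ.m≤m*n (suc p) (suc e)) (ℕ.<⇒≤ p*e<n*d)

-- 0 < q < n ^ δ iff q ^ d < n ^ p for some rational p / d < δ: as n ≥ 1,
-- n ^ δ is the supremum of the n ^ (p / d).

_^ℝ_ : (n : ℕ) .{{_ : ℕ.NonZero n}} → ℝ⁺ → ℝ⁺
n ^ℝ δ = record
  { _∋_       = λ q → 0ℚ ℚ.< q × ∃[ s ] s ∈ℝ δ × q ^ (↧ₙ s) ℚ.< (+ n / 1) ^ ℤ.∣ ↥ s ∣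
  ; positive  = proj₁
  ; downward  = λ 0<p p<q (_ , s , s∈δ , q<nˢ) →
                  0<p , s , s∈δ , ℚ.≤-<-trans (^-monoˡ-≤ (↧ₙ s) 0<p (ℚ.<⇒≤ p<q)) q<nˢ
  ; open-cut  = λ (0<q , s , s∈δ , q<nˢ) →
                  let r , q<r , r<nˢ = ^-open (↧ₙ s) 0<q q<nˢ in
                  r , q<r , ℚ.<-trans 0<q q<r , s , s∈δ , r<nˢ
  ; inhabited = let s , s∈δ = Δ.inhabited in
                ½ , ℚ.positive⁻¹ ½ , s , s∈δ ,
                ℚ.<-≤-trans (^-<1 (ℚ.denominator-1 s) (ℚ.positive⁻¹ ½) ½<1)
                            (1≤^ ℤ.∣ ↥ s ∣ (1≤n/1 n))
  ; bounded   = let b , δ<b = Δ.bounded in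
                (+ n / 1) ^ ℤ.∣ ↥ b ∣ , λ (0<q , s , s∈δ , q<nˢ) →
                  below b 0<q s (Δ.positive s∈δ) (δ<b s∈δ) q<nˢ
  }
  where
  module Δ = ℝ⁺ δ
  ½<1 : ½ ℚ.< 1ℚ
  ½<1 = ℚ.*<* (ℤ.+<+ (s≤s (s≤s z≤n)))
  below : ∀ b {q} → 0ℚ ℚ.< q → ∀ s → 0ℚ ℚ.< s → s ℚ.< b →
          q ^ (↧ₙ s) ℚ.< (+ n / 1) ^ ℤ.∣ ↥ s ∣ → q ℚ.< (+ n / 1) ^ ℤ.∣ ↥ b ∣
  below b {q} 0<q s 0<s s<b q<nˢ = ℚ.≰⇒> λ nᵇ≤q → ℚ.<-irrefl refl
    (ℚ.<-≤-trans q<nˢ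
      (ℚ.≤-trans (^-monoʳ-≤ (1≤n/1 n) (numerator-bound 0<s s<b))
        (subst (ℚ._≤ q ^ (↧ₙ s)) (^-assocʳ (+ n / 1) ℤ.∣ ↥ b ∣ (↧ₙ s))
          (^-monoˡ-≤ (↧ₙ s) (^-pos ℤ.∣ ↥ b ∣ (0<n/1 n)) nᵇ≤q))))

-- Graphs; up to isomorphism the vertex set is Fin of its cardinality.

record Graph : Set₁ where
  field
    ∣V∣          : ℕ
    {{nonEmpty}} : ℕ.NonZero ∣V∣
    E            : Rel (Fin ∣V∣) 0ℓ
    E?           : Decidable E
    loopless     : ∀ v → ¬ E v v

  V : Set
  V = Fin ∣V∣

  inDegree outDegree degree : V → ℕ
  inDegree  v = count (λ u → E? u v) (allFin ∣V∣)
  outDegree v = count (λ u → E? v u) (allFin ∣V∣)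
  degree    v = inDegree v ℕ.+ outDegree v

  IsSimplePath : ∀ {D} → Vec V (suc D) → Set
  IsSimplePath xs = Unique xs × Linked E xs

  IsCycle : ∀ {D} → Vec V (suc D) → Set
  IsCycle xs = IsSimplePath xs × E (last xs) (head xs)

  HasPathAvoiding : Subset ∣V∣ → ℕ → Set
  HasPathAvoiding S D = ∃[ xs ] IsSimplePath {D} xs × All (_∉ S) xs

anyVec? : ∀ {n m} {P : Vec (Fin n) m → Set} → U.Decidable P → Dec (∃ P)
anyVec? {m = zero}  P? = map′ ([] ,_) (λ { ([] , p) → p }) (P? [])
anyVec? {m = suc m} P? =
  map′ (λ (x , xs , p) → x ∷ xs , p) (λ { (x ∷ xs , p) → x , xs , p })
    (Fin.any? λ x → anyVec? λ xs → P? (x ∷ xs))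

IsMaximum : (ℕ → Set) → ℕ → Set
IsMaximum P m = P m × (∀ {k} → P k → k ℕ.≤ m)

maximum : ∀ {P} → U.Decidable P → ∃ P → ∀ b → (∀ {k} → P k → k ℕ.≤ b) → ∃ (IsMaximum P)
maximum P? (k , Pk) zero P≤b with P≤b Pk
... | z≤n = 0 , Pk , P≤b
maximum {P} P? ∃P (suc b) P≤b with P? (suc b)
... | yes Pb = suc b , Pb , P≤b
... | no ¬Pb = maximum P? ∃P b λ Pk →
  ℕ.≤-pred (ℕ.≤∧≢⇒< (P≤b Pk) λ { refl → ¬Pb Pk })

module _ (G : Graph) where
  open Graph G

  hasPathAvoiding? : ∀ S → U.Decidable (HasPathAvoiding S)
  hasPathAvoiding? S D = anyVec? λ xs →
    (allPairs? (λ u v → ¬? (u Fin.≟ v)) xs ×-dec linked? E? xs)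
      ×-dec all? (λ v → ¬? (v ∈? S)) xs

  pathLength≤ : ∀ {S D} → HasPathAvoiding S D → D ℕ.≤ ∣V∣
  pathLength≤ (xs , (unique , _) , _) =
    ℕ.<⇒≤ (Fin.injective⇒≤ λ {i} {j} → lookup-injective unique i j)

  longestPath : ∀ {S} → S ⊂ ⊤ → ∃ (IsMaximum (HasPathAvoiding S))
  longestPath {S} (_ , v , _ , v∉S) =
    maximum (hasPathAvoiding? S)
      (0 , v ∷ [] , ([] ∷ [] , [-]) , v∉S ∷ []) ∣V∣ pathLength≤

  codepth : (S : Subset ∣V∣) → S ⊂ ⊤ → ℕ
  codepth S S⊂V = proj₁ (longestPath S⊂V)

record DAG : Set₁ where
  field
    graph   : Graph
  open Graph graph public
  field
    acyclic : ∀ {D} (xs : Vec V (suc D)) → ¬ IsCycle xs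

IsExtender : ℝ⁺ → ℝ⁺ → DAG → Set
IsExtender ε ρ G =
  ∀ (S : Subset ∣V∣) (S⊂V : S ⊂ ⊤) →
  (+ ∣ S ∣ / 1) ℚ≤ℝ (ε *ℝ fromℕ ∣V∣) →
  ρ ℝ≤ℚ (+ codepth graph S S⊂V / 1)
  where open DAG G

BoundedDegrees BoundedInDegrees : (ℕ → DAG) → Set
BoundedDegrees   G = ∃[ Δ ] ∀ n v → DAG.degree   (G n) v ℕ.≤ Δ
BoundedInDegrees G = ∃[ Δ ] ∀ n v → DAG.inDegree (G n) v ℕ.≤ Δ

record IsExtenderSequence (ρ : (n : ℕ) .{{_ : ℕ.NonZero n}} → ℝ⁺) (G : ℕ → DAG) : Set₁ where
  field
    ρ→∞              : ∀ M → ∃[ N ] ∀ n .{{_ : ℕ.NonZero n}} → N ℕ.≤ n → (+ M / 1) ℚ≤ℝ ρ n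
    boundedInDegrees : BoundedInDegrees G
    ∣V∣→∞            : ∀ M → ∃[ N ] ∀ n → N ℕ.≤ n → M ℕ.≤ DAG.∣V∣ (G n)
    extender         : ∃[ ε ] ∃[ C ] ∀ n → let open DAG (G n) in IsExtender ε (C *ℝ ρ ∣V∣ {{nonEmpty}}) (G n)

-- δ rounds to 0.019: 0.0185 ≤ δ ≤ 0.0195.

_≈0·019 : ℝ⁺ → Set
δ ≈0·019 = (+ 37 / 2000) ℚ≤ℝ δ × δ ℝ≤ℚ (+ 39 / 2000)

{-# OPTIONS --safe #-}
module Submission where

-- The vertices are the pairs of a leaf t of the binary tree of depth L = 52 ℓ and a slot j among
-- m = 2 ℓ. Every vertex (t , j) draws D random arrows: an arrow picks a level s uniformly and, if t
-- lies to the right of its ancestor at level s, leads to a random vertex to the left of that ancestor.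
-- D does not depend on ℓ, and arrows into vertices of large in-degree are dropped.
--
-- Given S, let f be the length of the longest path outside S from a vertex, and F t a low quantile of f over the
-- slots of t. As f decreases along the arrows outside S, every draw made by a vertex with f ≤ F avoids
-- a set of draws that is determined by F and the set of vertices with f < F, in S or of large
-- in-degree. Since F only depends on the leaf, such a certificate has 3 N bits if f < 2 ^ m, so that a
-- union bound needs only boundedly many arrows per vertex. It shows that F t′ < F t for nearly all pairs
-- of leaves t′ , t that an arrow may join.
--
-- Then F nearly determines t: descend from the root and guess each bit of t by comparing F t with
-- a threshold at the current node. A value of F has at most C(L , i) preimages for which i guesses are
-- wrong, whereas few guesses are wrong on average, so that F takes exponentially many values in L.

module Combinatorics where

  open import Algebra.Properties.CommutativeSemigroup using (x∙yz≈y∙xz)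
  import Algebra.Properties.Semiring.Sum
  open import Data.Bool using (if_then_else_)
  open import Data.Fin using
    (Fin; zero; suc; combine; remQuot; quotient; remainder; toℕ; fromℕ<; finToFun; funToFin; _↑ˡ_; _↑ʳ_)
  open import Data.Fin.Patterns using (0F; 1F)
  import Data.Fin.Properties as Fin
  open import Data.Fin.Subset using (Subset; inside; outside; _∈_; _∉_; _⊂_; ⊤; ∣_∣)
  open import Data.Fin.Subset.Properties using (_∈?_)
  open import Data.Nat
  open import Data.Nat.DivMod using (_/_; m/n*n≤m; m/n<m; m≡m%n+[m/n]*n; m%n<n)
  open import Data.Nat.Properties
  open import Data.Nat.Tactic.RingSolver using (solve-∀)
  open import Data.Product using (∃; ∃-syntax; _×_; _,_; proj₁; proj₂)
  open import Data.Sum using (_⊎_; inj₁; inj₂)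
  open import Data.Unit using (tt)
  open import Data.Vec using (Vec; []; _∷_; head; last; lookup; count; tabulate)
  open import Data.Vec.Functional using (foldr) renaming (_∷_ to _∷ᶠ_)
  open import Data.Vec.Relation.Unary.All as All using (All; []; _∷_; all?)
  open import Data.Vec.Relation.Unary.AllPairs using ([]; _∷_; allPairs?)
  open import Data.Vec.Relation.Unary.Linked using (Linked; []; [-]; _∷_; linked?)
  open import Data.Vec.Relation.Unary.Unique.Propositional using (Unique)
  open import Defs using (Graph; DAG; IsMaximum; anyVec?; codepth; longestPath; maximum)
  open import Function using (_∘_; _∋_; id)
  open import Relation.Binary using (Decidable)
  open import Relation.Binary.PropositionalEquality
  open import Relation.Nullary using (Dec; yes; no; ¬_; ¬?; does; contradiction)
  open import Relation.Nullary.Decidable using (_×-dec_; _⊎-dec_; decidable-stable)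
  import Relation.Unary as U

  open Algebra.Properties.Semiring.Sum +-*-semiring
    using (∑-distrib-+; ∑-comm; *-distribˡ-sum; *-distribʳ-sum)
    renaming (sum to ∑; sum-cong-≗ to ∑-cong)

  private variable
    n m r c L : ℕ
    P Q R : Set

  -- Finite sums, products and indicators.

  ∏ : (Fin n → ℕ) → ℕ
  ∏ = foldr _*_ 1

  𝟙 : Dec P → ℕ
  𝟙 p = if does p then 1 else 0

  𝟙-true : (p : Dec P) → P → 𝟙 p ≡ 1
  𝟙-true (yes _) _ = refl
  𝟙-true (no ¬p) p = contradiction p ¬p

  𝟙-false : (p : Dec P) → ¬ P → 𝟙 p ≡ 0
  𝟙-false (yes p) ¬p = contradiction p ¬p
  𝟙-false (no _)  _  = refl

  𝟙≤1 : (p : Dec P) → 𝟙 p ≤ 1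
  𝟙≤1 (yes _) = ≤-refl
  𝟙≤1 (no _)  = z≤n

  𝟙-mono : (p : Dec P) (q : Dec Q) → (P → Q) → 𝟙 p ≤ 𝟙 q
  𝟙-mono (no _)  q f = z≤n
  𝟙-mono (yes p) q f = ≤-reflexive (sym (𝟙-true q (f p)))

  𝟙-⊎ : (p : Dec P) (q : Dec Q) (r : Dec R) → (P → Q ⊎ R) → 𝟙 p ≤ 𝟙 q + 𝟙 r
  𝟙-⊎ (no _)  q r f = z≤n
  𝟙-⊎ (yes p) q r f with f p
  ... | inj₁ x = ≤-trans (≤-reflexive (sym (𝟙-true q x))) (m≤m+n _ _)
  ... | inj₂ x = ≤-trans (≤-reflexive (sym (𝟙-true r x))) (m≤n+m _ _)

  𝟙-× : (p : Dec P) (q : Dec Q) (r : Dec R) → (P → Q → R) → 𝟙 p * 𝟙 q ≤ 𝟙 r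
  𝟙-× (no _)  q r f = z≤n
  𝟙-× (yes p) q r f = ≤-trans (≤-reflexive (*-identityˡ _)) (𝟙-mono q r (f p))

  ∑-mono : {f g : Fin n → ℕ} → (∀ i → f i ≤ g i) → ∑ f ≤ ∑ g
  ∑-mono {zero}  f≤g = z≤n
  ∑-mono {suc n} f≤g = +-mono-≤ (f≤g zero) (∑-mono (f≤g ∘ suc))

  ∑-zero : ∑ {n} (λ _ → 0) ≡ 0
  ∑-zero {zero}  = refl
  ∑-zero {suc n} = ∑-zero {n}

  ∑-const : ∀ n x → ∑ {n} (λ _ → x) ≡ n * x
  ∑-const zero    x = refl
  ∑-const (suc n) x = cong (x +_) (∑-const n x)

  ∑-≤ : ∀ {f : Fin n → ℕ} {x} → (∀ i → f i ≤ x) → ∑ f ≤ n * x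
  ∑-≤ {n} {x = x} f≤x = ≤-trans (∑-mono f≤x) (≤-reflexive (∑-const n x))

  term≤∑ : (f : Fin n → ℕ) (i : Fin n) → f i ≤ ∑ f
  term≤∑ f zero    = m≤m+n _ _
  term≤∑ f (suc i) = ≤-trans (term≤∑ (f ∘ suc) i) (m≤n+m _ _)

  ∑-split : ∀ m (f : Fin (m + n) → ℕ) → ∑ f ≡ ∑ (λ i → f (i ↑ˡ n)) + ∑ (λ j → f (m ↑ʳ j))
  ∑-split zero    f = refl
  ∑-split (suc m) f = trans (cong (f zero +_) (∑-split m (f ∘ suc))) (sym (+-assoc (f zero) _ _))

  ∑-combine : ∀ m (f : Fin (m * n) → ℕ) → ∑ f ≡ ∑ (λ i → ∑ (λ j → f (combine {m} i j)))
  ∑-combine zero    f = refl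
  ∑-combine {n} (suc m) f = trans (∑-split n f) (cong (∑ (λ j → f (j ↑ˡ m * n)) +_) (∑-combine m (f ∘ (n ↑ʳ_))))

  ∑-𝟙-≡ : (x : Fin n) → ∑ (λ i → 𝟙 (i Fin.≟ x)) ≤ 1
  ∑-𝟙-≡ {suc n} zero    = s≤s (≤-reflexive (∑-zero {n}))
  ∑-𝟙-≡ {suc n} (suc x) = ≤-trans (∑-mono λ i → 𝟙-mono (suc i Fin.≟ suc x) (i Fin.≟ x) Fin.suc-injective) (∑-𝟙-≡ x)

  ∑-pigeonhole : ∀ r {x} (f : Fin r → ℕ) → ∑ f < r * x → ∃[ i ] f i < x
  ∑-pigeonhole (suc r) {x} f lt with f zero <? x
  ... | yes f0<x = zero , f0<x
  ... | no  f0≮x = let i , fi<x = ∑-pigeonhole r (f ∘ suc)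
                         (+-cancelˡ-< x _ _ (≤-<-trans (+-monoˡ-≤ _ (≮⇒≥ f0≮x)) lt))
                   in suc i , fi<x

  count-tabulate : {A : Set} {P : A → Set} (P? : U.Decidable P) (f : Fin n → A) →
                   count P? (tabulate f) ≡ ∑ (λ i → 𝟙 (P? (f i)))
  count-tabulate {zero}  P? f = refl
  count-tabulate {suc n} P? f with P? (f zero)
  ... | yes _ = cong suc (count-tabulate P? (f ∘ suc))
  ... | no  _ = count-tabulate P? (f ∘ suc)

  ∣S∣≡∑ : (S : Subset n) → ∣ S ∣ ≡ ∑ (λ i → 𝟙 (i ∈? S))
  ∣S∣≡∑ []            = refl
  ∣S∣≡∑ (inside  ∷ S) = cong suc (∣S∣≡∑ S)
  ∣S∣≡∑ (outside ∷ S) = ∣S∣≡∑ S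

  -- Method of conditional expectations: the draws are fixed one at a time without increasing the mean.
  derandomize : ∀ n (a : Fin c → ℕ) (q : Fin c → Fin n → Fin r → ℕ) →
                ∑ (λ e → a e * ∏ (λ i → ∑ (q e i))) < r ^ n →
                ∃ λ (g : Fin n → Fin r) → ∑ (λ e → a e * ∏ (λ i → q e i (g i))) < 1
  derandomize zero a q lt = (λ ()) , lt
  derandomize {r = r} (suc n) a q lt =
    let ω , ltω = ∑-pigeonhole r _ (subst (_< r ^ suc n) swap lt)
        g , ltg = derandomize n (λ e → a e * q e zero ω) (λ e → q e ∘ suc) ltω
    in ω ∷ᶠ g
     , subst (_< 1) (∑-cong λ e → *-assoc (a e) (q e zero ω) (∏ λ i → q e (suc i) (g i))) ltg
    where
    rest : Fin _ → ℕ
    rest e = ∏ (λ i → ∑ (q e (suc i)))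
    swap : ∑ (λ e → a e * (∑ (q e zero) * rest e)) ≡ ∑ (λ ω → ∑ (λ e → a e * q e zero ω * rest e))
    swap = trans (∑-cong λ e → begin
        a e * (∑ (q e zero) * rest e)          ≡⟨ *-assoc (a e) _ _ ⟨
        a e * ∑ (q e zero) * rest e            ≡⟨ cong (_* rest e) (*-distribˡ-sum (a e) (q e zero)) ⟩
        ∑ (λ ω → a e * q e zero ω) * rest e    ≡⟨ *-distribʳ-sum (rest e) (λ ω → a e * q e zero ω) ⟩
        ∑ (λ ω → a e * q e zero ω * rest e)    ∎)
      (∑-comm (λ e ω → a e * q e zero ω * rest e))
      where open ≡-Reasoning

  -- Inequalities for products and powers, and quantiles.

  ∏-bound : ∀ κ (x : Fin n → ℕ) {A : Fin n → Set} (A? : U.Decidable A) →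
            (∀ i → x i ≤ r) → (∀ i → A i → suc κ * x i ≤ κ * r) →
            let k = ∑ (λ i → 𝟙 (A? i)) in suc κ ^ k * ∏ x ≤ κ ^ k * r ^ n
  ∏-bound {zero}  κ x A? x≤r small = ≤-refl
  ∏-bound {suc n} {r} κ x A? x≤r small with A? zero | ∏-bound κ (x ∘ suc) (A? ∘ suc) (x≤r ∘ suc) (small ∘ suc)
  ... | yes A0 | ih = begin
    suc κ * suc κ ^ k * (x zero * ∏ (x ∘ suc))     ≡⟨ [m*n]*[o*p]≡[m*o]*[n*p] (suc κ) (suc κ ^ k) (x zero) _ ⟩
    suc κ * x zero * (suc κ ^ k * ∏ (x ∘ suc))     ≤⟨ *-mono-≤ (small zero A0) ih ⟩
    κ * r * (κ ^ k * r ^ n)                        ≡⟨ [m*n]*[o*p]≡[m*o]*[n*p] κ r (κ ^ k) (r ^ n) ⟩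
    κ * κ ^ k * (r * r ^ n)                        ∎
    where
    open ≤-Reasoning
    k = ∑ (λ i → 𝟙 (A? (suc i)))
  ... | no _ | ih = begin
    suc κ ^ k * (x zero * ∏ (x ∘ suc))     ≡⟨ x∙yz≈y∙xz *-commutativeSemigroup (suc κ ^ k) (x zero) _ ⟩
    x zero * (suc κ ^ k * ∏ (x ∘ suc))     ≤⟨ *-mono-≤ (x≤r zero) ih ⟩
    r * (κ ^ k * r ^ n)                    ≡⟨ x∙yz≈y∙xz *-commutativeSemigroup r (κ ^ k) (r ^ n) ⟩
    κ ^ k * (r * r ^ n)                    ∎
    where
    open ≤-Reasoning
    k = ∑ (λ i → 𝟙 (A? (suc i)))

  -- Bernoulli's inequality (1 + 1 / κ) ^ n ≥ 1 + n / κ, multiplied by κ ^ (n + 1).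
  bernoulli : ∀ κ n → κ ^ n * (κ + n) ≤ suc κ ^ n * κ
  bernoulli κ zero    = ≤-reflexive (cong (1 *_) (+-identityʳ κ))
  bernoulli κ (suc n) = begin
    κ * κ ^ n * (κ + suc n)                   ≤⟨ lemma κ (κ ^ n) n ⟩
    suc κ * (κ ^ n * (κ + n))                 ≤⟨ *-monoʳ-≤ (suc κ) (bernoulli κ n) ⟩
    suc κ * (suc κ ^ n * κ)                   ≡⟨ *-assoc (suc κ) (suc κ ^ n) κ ⟨
    suc κ * suc κ ^ n * κ                     ∎
    where
    open ≤-Reasoning
    lemma : ∀ κ y n → κ * y * (κ + suc n) ≤ suc κ * (y * (κ + n))
    lemma κ y n = ≤-trans (m≤m+n _ (y * n)) (≤-reflexive (eq κ y n))
      where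
      eq : ∀ κ y n → κ * y * (κ + (1 + n)) + y * n ≡ (1 + κ) * (y * (κ + n))
      eq = solve-∀

  -- The search finds the least `a` with more than `k` values at most `a`. It ends before `H`, since
  -- all `n` > `k` values lie below `H`.
  quantile : ∀ (f : Fin n → ℕ) H k → k < n → (∀ i → f i < H) →
             ∃[ a ] a < H × ∑ (λ i → 𝟙 (f i <? a)) ≤ k × k < ∑ (λ i → 𝟙 (f i ≤? a))
  quantile {n} f H k k<n f<H = search 0 H refl
    (≤-trans (≤-reflexive (∑-zero {n})) z≤n)
    where
    search : ∀ a fuel → a + fuel ≡ H → ∑ (λ i → 𝟙 (f i <? a)) ≤ k →
             ∃[ a ] a < H × ∑ (λ i → 𝟙 (f i <? a)) ≤ k × k < ∑ (λ i → 𝟙 (f i ≤? a))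
    search a zero eq le = contradiction (≤-trans all≥ le) (<⇒≱ k<n)
      where
      all≥ : n ≤ ∑ (λ i → 𝟙 (f i <? a))
      all≥ = ≤-trans (≤-reflexive (sym (trans (∑-const n 1) (*-identityʳ n))))
        (∑-mono λ i → ≤-reflexive (sym (𝟙-true (f i <? a)
          (subst (f i <_) (trans (sym eq) (+-identityʳ a)) (f<H i)))))
    search a (suc fuel) eq le with k <? ∑ (λ i → 𝟙 (f i ≤? a))
    ... | yes lt = a , m+n≤o⇒m≤o (suc a) (≤-reflexive (trans (sym (+-suc a fuel)) eq)) , le , lt
    ... | no ¬lt = search (suc a) fuel (trans (sym (+-suc a fuel)) eq)
      (≤-trans (∑-mono λ i → 𝟙-mono (f i <? suc a) (f i ≤? a) s≤s⁻¹) (≮⇒≥ ¬lt))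

  -- Leaves of the binary tree and violations of monotonicity.

  Leaf : ℕ → Set
  Leaf = Vec (Fin 2)

  -- The first bit is the most significant, so that the order of the codes is the order of the
  -- leaves from left to right.
  dec : Fin (2 ^ L) → Leaf L
  dec {zero}  x = []
  dec {suc L} x = let b , y = remQuot {2} (2 ^ L) x in b ∷ dec y

  enc : Leaf L → Fin (2 ^ L)
  enc []      = zero
  enc (b ∷ t) = combine b (enc t)

  dec-combine : ∀ b (y : Fin (2 ^ L)) → dec {suc L} (combine b y) ≡ b ∷ dec y
  dec-combine {L} b y = cong (λ (b , y) → b ∷ dec y) (Fin.remQuot-combine {2} {2 ^ L} b y)

  dec-enc : (t : Leaf L) → dec (enc t) ≡ t
  dec-enc []      = refl
  dec-enc (b ∷ t) = trans (dec-combine b (enc t)) (cong (b ∷_) (dec-enc t))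

  ∑ᴸ : (Leaf L → ℕ) → ℕ
  ∑ᴸ f = ∑ (f ∘ dec)

  ∑ᴸ-suc : (f : Leaf (suc L) → ℕ) → ∑ᴸ f ≡ ∑ᴸ (f ∘ (0F ∷_)) + ∑ᴸ (f ∘ (1F ∷_))
  ∑ᴸ-suc {L} f = trans (∑-combine {2 ^ L} 2 (f ∘ dec)) (cong₂ _+_
    (∑-cong λ y → cong f (dec-combine 0F y))
    (trans (+-identityʳ _) (∑-cong λ y → cong f (dec-combine 1F y))))

  bit : Fin L → Leaf L → Fin 2
  bit s t = lookup t s

  -- The bits of t above s followed by the bits of u from s on.
  mix : Fin L → Leaf L → Leaf L → Leaf L
  mix zero    t       u       = u
  mix (suc s) (b ∷ t) (c ∷ u) = b ∷ mix s t u

  -- In this case `t` lies to the right and `mix s t u` to the left of the ancestor of `t` at level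
  -- `s`.
  Down : Fin L → Leaf L → Leaf L → Set
  Down s t u = bit s t ≡ 1F × bit s u ≡ 0F

  Down? : (s : Fin L) (t u : Leaf L) → Dec (Down s t u)
  Down? s t u = (bit s t Fin.≟ 1F) ×-dec (bit s u Fin.≟ 0F)

  Violation : (Leaf L → ℕ) → Fin L → Leaf L → Leaf L → Set
  Violation F s t u = Down s t u × F t ≤ F (mix s t u)

  Violation? : (F : Leaf L → ℕ) (s : Fin L) (t u : Leaf L) → Dec (Violation F s t u)
  Violation? F s t u = Down? s t u ×-dec (F t ≤? F (mix s t u))

  -- The bits of `u` above `s` have no influence, so a pair of `t` and `mix s t u` is counted 2 ^ s
  -- times. This gives all levels equal weight.
  violations : (Leaf L → ℕ) → ℕ
  violations F = ∑ λ s → ∑ᴸ λ t → ∑ᴸ λ u → 𝟙 (Violation? F s t u)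

  crossings : (Leaf L → ℕ) → (Leaf L → ℕ) → ℕ
  crossings F₀ F₁ = ∑ᴸ λ y → ∑ᴸ λ x → 𝟙 (F₁ y ≤? F₀ x)

  -- The top level contributes the crossings of the two halves. A violation inside a half is counted
  -- twice, once for each first bit of `u`.
  violations-suc : (F : Leaf (suc L) → ℕ) →
    let F₀ = F ∘ (0F ∷_); F₁ = F ∘ (1F ∷_) in
    crossings F₀ F₁ + 2 * (violations F₀ + violations F₁) ≤ violations F
  violations-suc {L} F = +-mono-≤ cross (≤-trans (≤-reflexive twice) (∑-mono below))
    where
    F′ : Fin 2 → Leaf L → ℕ
    F′ b t = F (b ∷ t)
    cross : crossings (F′ 0F) (F′ 1F) ≤ ∑ᴸ λ t → ∑ᴸ λ u → 𝟙 (Violation? F zero t u)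
    cross = begin
      crossings (F′ 0F) (F′ 1F)
        ≤⟨ ∑-mono (λ y → ∑-mono λ x → 𝟙-mono (F′ 1F (dec y) ≤? F′ 0F (dec x))
             (Violation? F zero (1F ∷ dec y) (0F ∷ dec x)) ((refl , refl) ,_)) ⟩
      (∑ᴸ λ y → ∑ᴸ λ x → 𝟙 (Violation? F zero (1F ∷ y) (0F ∷ x)))
        ≤⟨ ∑-mono (λ y → ≤-trans (m≤m+n _ _) (≤-reflexive (sym (∑ᴸ-suc (λ u → 𝟙 (Violation? F zero (1F ∷ dec y) u)))))) ⟩
      (∑ᴸ λ y → ∑ᴸ λ u → 𝟙 (Violation? F zero (1F ∷ y) u))
        ≤⟨ ≤-trans (m≤n+m _ _) (≤-reflexive (sym (∑ᴸ-suc (λ t → ∑ᴸ λ u → 𝟙 (Violation? F zero t u))))) ⟩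
      (∑ᴸ λ t → ∑ᴸ λ u → 𝟙 (Violation? F zero t u)) ∎
      where open ≤-Reasoning
    V : (b : Fin 2) (s : Fin L) → ℕ
    V b s = ∑ᴸ λ t → ∑ᴸ λ u → 𝟙 (Violation? (F′ b) s t u)
    twice : 2 * (violations (F′ 0F) + violations (F′ 1F)) ≡ ∑ λ s → 2 * V 0F s + 2 * V 1F s
    twice = trans (*-distribˡ-+ 2 (violations (F′ 0F)) _)
      (trans (cong₂ _+_ (*-distribˡ-sum 2 (V 0F)) (*-distribˡ-sum 2 (V 1F)))
             (sym (∑-distrib-+ (λ s → 2 * V 0F s) (λ s → 2 * V 1F s))))
    lift : ∀ b c s t u → 𝟙 (Violation? (F′ b) s t u) ≤ 𝟙 (Violation? F (suc s) (b ∷ t) (c ∷ u))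
    lift b c s t u = 𝟙-mono (Violation? (F′ b) s t u) (Violation? F (suc s) (b ∷ t) (c ∷ u)) id
    half : ∀ b s → 2 * V b s ≤ ∑ᴸ λ t → ∑ᴸ λ u → 𝟙 (Violation? F (suc s) (b ∷ t) u)
    half b s = ≤-trans (≤-reflexive (*-distribˡ-sum 2 (λ x → ∑ᴸ λ u → 𝟙 (Violation? (F′ b) s (dec x) u))))
      (∑-mono λ x → ≤-trans
        (+-mono-≤ (∑-mono (λ y → lift b 0F s (dec x) (dec y)))
                  (≤-trans (≤-reflexive (+-identityʳ _)) (∑-mono (λ y → lift b 1F s (dec x) (dec y)))))
        (≤-reflexive (sym (∑ᴸ-suc (λ u → 𝟙 (Violation? F (suc s) (b ∷ dec x) u))))))
    below : ∀ s → 2 * V 0F s + 2 * V 1F s ≤ ∑ᴸ λ t → ∑ᴸ λ u → 𝟙 (Violation? F (suc s) t u)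
    below s = ≤-trans (+-mono-≤ (half 0F s) (half 1F s))
      (≤-reflexive (sym (∑ᴸ-suc (λ t → ∑ᴸ λ u → 𝟙 (Violation? F (suc s) t u)))))

  -- Guessing a leaf from its value.

  n<[1+n/q]*q : ∀ n q .{{_ : NonZero q}} → n < suc (n / q) * q
  n<[1+n/q]*q n q = subst (_< suc (n / q) * q) (sym (m≡m%n+[m/n]*n n q)) (+-monoˡ-< _ (m%n<n n q))

  -- The guesses on the way down depend only on the value `h` and the current node, so a leaf of
  -- value `h` is known once it is known which guesses are wrong. Summing 2 ^ (number of right
  -- guesses) over all patterns gives (1 + 2) ^ L, the bound in `decode`. Cleared of denominators,
  -- `mis-rare` says that the mean of `mis` is at most L / q + 2 q v, where v is `violations F`
  -- divided by 4 ^ L.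
  record Predictor (q : ℕ) (F : Leaf L → ℕ) : Set where
    field
      mis cor  : Leaf L → ℕ
      mis+cor  : ∀ t → mis t + cor t ≡ L
      decode   : ∀ h → ∑ᴸ (λ t → 𝟙 (F t ≟ h) * 2 ^ cor t) ≤ 3 ^ L
      mis-rare : q * (2 ^ L * ∑ᴸ mis) ≤ L * (2 ^ L * 2 ^ L) + 2 * (q * q) * violations F

  -- The guess is the right half exactly for values from θ on, where θ is the lower quantile of `F₁`
  -- of order 1 / q. At most 2 ^ L / q right leaves have values below θ, and at least as many as 2 ^
  -- L / q have values at most θ. Each of the latter crosses every left leaf of value at least θ, so
  -- wrong guesses on the left are paid for by crossings.
  threshold : ∀ q → 2 ≤ q → (F₀ F₁ : Leaf L → ℕ) →
    ∃[ θ ] q * (2 ^ L * (∑ᴸ (λ x → 𝟙 (θ ≤? F₀ x)) + ∑ᴸ (λ y → 𝟙 (F₁ y <? θ))))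
           ≤ 2 ^ L * 2 ^ L + q * q * crossings F₀ F₁
  threshold {L} q@(suc (suc _)) 2≤q@(s≤s (s≤s _)) F₀ F₁ = θ , (begin
      q * (w * (a + b))               ≡⟨ expand q w a b ⟩
      q * (w * a) + w * (b * q)       ≤⟨ +-mono-≤ (*-monoʳ-≤ q wa≤) (*-monoʳ-≤ w bq≤w) ⟩
      q * (q * V) + w * w             ≡⟨ trans (+-comm (q * (q * V)) _) (cong (w * w +_) (sym (*-assoc q q V))) ⟩
      w * w + q * q * V               ∎)
    where
    open ≤-Reasoning
    w = 2 ^ L
    instance w≢0 = m^n≢0 2 L
    k = w / q
    k<w : k < w
    k<w = m/n<m w q (s≤s (s≤s z≤n))
    H = suc (∑ᴸ F₁)
    found = quantile (F₁ ∘ dec) H k k<w (λ y → s≤s (term≤∑ (F₁ ∘ dec) y))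
    θ = proj₁ found
    a = ∑ᴸ (λ x → 𝟙 (θ ≤? F₀ x))
    b = ∑ᴸ (λ y → 𝟙 (F₁ y <? θ))
    V = crossings F₀ F₁
    e = ∑ᴸ (λ y → 𝟙 (F₁ y ≤? θ))
    bq≤w : b * q ≤ w
    bq≤w = ≤-trans (*-monoˡ-≤ q (proj₁ (proj₂ (proj₂ found)))) (m/n*n≤m w q)
    k<e : k < e
    k<e = proj₂ (proj₂ (proj₂ found))
    ea≤V : e * a ≤ V
    ea≤V = begin
      e * a                                                  ≡⟨ *-distribʳ-sum a (λ y → 𝟙 (F₁ (dec y) ≤? θ)) ⟩
      ∑ᴸ (λ y → 𝟙 (F₁ y ≤? θ) * a)                            ≡⟨ ∑-cong (λ y → *-distribˡ-sum (𝟙 (F₁ (dec y) ≤? θ)) (λ x → 𝟙 (θ ≤? F₀ (dec x)))) ⟩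
      ∑ᴸ (λ y → ∑ᴸ (λ x → 𝟙 (F₁ y ≤? θ) * 𝟙 (θ ≤? F₀ x)))      ≤⟨ ∑-mono (λ y → ∑-mono λ x → 𝟙-× (F₁ (dec y) ≤? θ) (θ ≤? F₀ (dec x)) (F₁ (dec y) ≤? F₀ (dec x)) ≤-trans) ⟩
      V                                                      ∎
    wa≤ : w * a ≤ q * V
    wa≤ = begin
      w * a             ≤⟨ *-monoˡ-≤ a (<⇒≤ (n<[1+n/q]*q w q)) ⟩
      suc k * q * a     ≤⟨ *-monoˡ-≤ a (*-monoˡ-≤ q k<e) ⟩
      e * q * a         ≡⟨ trans (cong (_* a) (*-comm e q)) (*-assoc q e a) ⟩
      q * (e * a)       ≤⟨ *-monoʳ-≤ q ea≤V ⟩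
      q * V             ∎
    expand : ∀ q w a b → q * (w * (a + b)) ≡ q * (w * a) + w * (b * q)
    expand = solve-∀

  graft : (f₀ f₁ : Leaf L → ℕ) → Leaf (suc L) → ℕ
  graft f₀ f₁ (0F ∷ t) = f₀ t
  graft f₀ f₁ (1F ∷ t) = f₁ t

  predictor : ∀ q → 2 ≤ q → (F : Leaf L → ℕ) → Predictor q F
  predictor {zero} q 2≤q F = record
    { mis = λ _ → 0 ; cor = λ _ → 0 ; mis+cor = λ _ → refl
    ; decode = λ h → ≤-trans (≤-reflexive (trans (+-identityʳ _) (*-identityʳ _))) (𝟙≤1 (F [] ≟ h))
    ; mis-rare = ≤-trans (≤-reflexive (*-zeroʳ q)) z≤n }
  predictor {suc L} q 2≤q F = record
    { mis = mis ; cor = cor ; mis+cor = mis+cor ; decode = decode ; mis-rare = mis-rare }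
    where
    F₀ F₁ : Leaf L → ℕ
    F₀ t = F (0F ∷ t)
    F₁ t = F (1F ∷ t)
    module P₀ = Predictor (predictor q 2≤q F₀)
    module P₁ = Predictor (predictor q 2≤q F₁)
    θ = proj₁ (threshold {L} q 2≤q F₀ F₁)
    mis₀ mis₁ cor₀ cor₁ : Leaf L → ℕ
    mis₀ t = P₀.mis t + 𝟙 (θ ≤? F₀ t)
    mis₁ t = P₁.mis t + 𝟙 (F₁ t <? θ)
    cor₀ t = P₀.cor t + 𝟙 (F₀ t <? θ)
    cor₁ t = P₁.cor t + 𝟙 (θ ≤? F₁ t)
    mis = graft mis₀ mis₁
    cor = graft cor₀ cor₁
    𝟙≤+𝟙< : ∀ x → 𝟙 (θ ≤? x) + 𝟙 (x <? θ) ≡ 1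
    𝟙≤+𝟙< x with θ ≤? x
    ... | yes le = cong₂ _+_ (𝟙-true (θ ≤? x) le) (𝟙-false (x <? θ) (≤⇒≯ le))
    ... | no ¬le = cong₂ _+_ (𝟙-false (θ ≤? x) ¬le) (𝟙-true (x <? θ) (≰⇒> ¬le))
    shuffle : ∀ a b c d → (a + b) + (c + d) ≡ (a + c) + (b + d)
    shuffle = solve-∀
    mis+cor : ∀ t → mis t + cor t ≡ suc L
    mis+cor (0F ∷ t) =
      trans (shuffle (P₀.mis t) (𝟙 (θ ≤? F₀ t)) (P₀.cor t) _)
        (trans (cong₂ _+_ (P₀.mis+cor t) (𝟙≤+𝟙< (F₀ t))) (+-comm L 1))
    mis+cor (1F ∷ t) =
      trans (shuffle (P₁.mis t) (𝟙 (F₁ t <? θ)) (P₁.cor t) _)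
        (trans (cong₂ _+_ (P₁.mis+cor t) (trans (+-comm (𝟙 (F₁ t <? θ)) _) (𝟙≤+𝟙< (F₁ t)))) (+-comm L 1))

    decode : ∀ h → ∑ᴸ (λ t → 𝟙 (F t ≟ h) * 2 ^ cor t) ≤ 3 ^ suc L
    decode h = begin
      ∑ᴸ (λ t → 𝟙 (F t ≟ h) * 2 ^ cor t)
        ≡⟨ ∑ᴸ-suc (λ t → 𝟙 (F t ≟ h) * 2 ^ cor t) ⟩
      ∑ᴸ (λ t → 𝟙 (F₀ t ≟ h) * 2 ^ cor (0F ∷ t)) + ∑ᴸ (λ t → 𝟙 (F₁ t ≟ h) * 2 ^ cor (1F ∷ t))
        ≤⟨ +-mono-≤ left right ⟩
      2 ^ 𝟙 (h <? θ) * 3 ^ L + 2 ^ 𝟙 (θ ≤? h) * 3 ^ L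
        ≡⟨ *-distribʳ-+ (3 ^ L) (2 ^ 𝟙 (h <? θ)) _ ⟨
      (2 ^ 𝟙 (h <? θ) + 2 ^ 𝟙 (θ ≤? h)) * 3 ^ L
        ≡⟨ cong (_* 3 ^ L) three ⟩
      3 * 3 ^ L ∎
      where
      open ≤-Reasoning
      -- The value `h` selects one half: there the guess is right and has weight 2, in the other
      -- half it is wrong and has weight 1.
      three : 2 ^ 𝟙 (h <? θ) + 2 ^ 𝟙 (θ ≤? h) ≡ 3
      three with h <? θ
      ... | yes lt = cong₂ (λ x y → 2 ^ x + 2 ^ y) (𝟙-true (h <? θ) lt) (𝟙-false (θ ≤? h) (<⇒≱ lt))
      ... | no ¬lt = cong₂ (λ x y → 2 ^ x + 2 ^ y) (𝟙-false (h <? θ) ¬lt) (𝟙-true (θ ≤? h) (≮⇒≥ ¬lt))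
      factor : ∀ (G c : Leaf L → ℕ) (i : ℕ → ℕ) t →
               𝟙 (G t ≟ h) * 2 ^ (c t + i (G t)) ≤ 2 ^ i h * (𝟙 (G t ≟ h) * 2 ^ c t)
      factor G c i t with G t ≟ h
      ... | no ≢h = ≤-trans (≤-reflexive (cong (_* 2 ^ (c t + i (G t))) (𝟙-false (G t ≟ h) ≢h))) z≤n
      ... | yes ≡h = ≤-reflexive (trans
        (cong (λ g → 𝟙 (G t ≟ h) * 2 ^ (c t + i g)) ≡h)
        (trans (cong (𝟙 (G t ≟ h) *_) (^-distribˡ-+-* 2 (c t) (i h)))
          (assoc (𝟙 (G t ≟ h)) (2 ^ c t) (2 ^ i h))))
        where
        assoc : ∀ x y z → x * (y * z) ≡ z * (x * y)
        assoc = solve-∀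
      side : ∀ (G c : Leaf L → ℕ) (i : ℕ → ℕ) →
             ∑ᴸ (λ t → 𝟙 (G t ≟ h) * 2 ^ c t) ≤ 3 ^ L →
             ∑ᴸ (λ t → 𝟙 (G t ≟ h) * 2 ^ (c t + i (G t))) ≤ 2 ^ i h * 3 ^ L
      side G c i ih = begin
        ∑ᴸ (λ t → 𝟙 (G t ≟ h) * 2 ^ (c t + i (G t)))   ≤⟨ ∑-mono (λ x → factor G c i (dec x)) ⟩
        ∑ᴸ (λ t → 2 ^ i h * (𝟙 (G t ≟ h) * 2 ^ c t))   ≡⟨ *-distribˡ-sum (2 ^ i h) (λ x → 𝟙 (G (dec x) ≟ h) * 2 ^ c (dec x)) ⟨
        2 ^ i h * ∑ᴸ (λ t → 𝟙 (G t ≟ h) * 2 ^ c t)     ≤⟨ *-monoʳ-≤ (2 ^ i h) ih ⟩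
        2 ^ i h * 3 ^ L                               ∎
      left  = side F₀ P₀.cor (λ x → 𝟙 (x <? θ)) (P₀.decode h)
      right = side F₁ P₁.cor (λ x → 𝟙 (θ ≤? x)) (P₁.decode h)

    mis-rare : q * (2 ^ suc L * ∑ᴸ mis) ≤ suc L * (2 ^ suc L * 2 ^ suc L) + 2 * (q * q) * violations F
    mis-rare = begin
      q * (2 * w * ∑ᴸ mis)
        ≡⟨ cong (λ x → q * (2 * w * x)) ∑mis ⟩
      q * (2 * w * ((M₀ + a) + (M₁ + b)))
        ≡⟨ expand q w M₀ M₁ a b ⟩
      2 * (q * (w * M₀)) + 2 * (q * (w * M₁)) + 2 * (q * (w * (a + b)))
        ≤⟨ +-mono-≤ (+-mono-≤ (*-monoʳ-≤ 2 P₀.mis-rare) (*-monoʳ-≤ 2 P₁.mis-rare))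
                    (*-monoʳ-≤ 2 (proj₂ (threshold {L} q 2≤q F₀ F₁))) ⟩
      2 * (L * (w * w) + 2 * (q * q) * v₀) + 2 * (L * (w * w) + 2 * (q * q) * v₁) + 2 * (w * w + q * q * x)
        -- The root costs 2 w². It is padded to 4 w², the share of one level in the tree with 2 w
        -- leaves.
        ≤⟨ m≤m+n _ (2 * (w * w)) ⟩
      2 * (L * (w * w) + 2 * (q * q) * v₀) + 2 * (L * (w * w) + 2 * (q * q) * v₁) + 2 * (w * w + q * q * x) + 2 * (w * w)
        ≡⟨ collect L q w v₀ v₁ x ⟩
      suc L * (2 * w * (2 * w)) + 2 * (q * q) * (x + 2 * (v₀ + v₁))
        ≤⟨ +-monoʳ-≤ (suc L * (2 * w * (2 * w))) (*-monoʳ-≤ (2 * (q * q)) (violations-suc F)) ⟩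
      suc L * (2 * w * (2 * w)) + 2 * (q * q) * violations F ∎
      where
      open ≤-Reasoning
      w = 2 ^ L
      M₀ = ∑ᴸ P₀.mis
      M₁ = ∑ᴸ P₁.mis
      a = ∑ᴸ (λ t → 𝟙 (θ ≤? F₀ t))
      b = ∑ᴸ (λ t → 𝟙 (F₁ t <? θ))
      x = crossings F₀ F₁
      v₀ = violations F₀
      v₁ = violations F₁
      ∑mis : ∑ᴸ mis ≡ (M₀ + a) + (M₁ + b)
      ∑mis = trans (∑ᴸ-suc mis) (cong₂ _+_
        (∑-distrib-+ (P₀.mis ∘ dec) (λ x → 𝟙 (θ ≤? F₀ (dec x))))
        (∑-distrib-+ (P₁.mis ∘ dec) (λ x → 𝟙 (F₁ (dec x) <? θ))))
      expand : ∀ q w M₀ M₁ a b → q * (2 * w * ((M₀ + a) + (M₁ + b))) ≡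
               2 * (q * (w * M₀)) + 2 * (q * (w * M₁)) + 2 * (q * (w * (a + b)))
      expand = solve-∀
      collect : ∀ L q w v₀ v₁ x →
        2 * (L * (w * w) + 2 * (q * q) * v₀) + 2 * (L * (w * w) + 2 * (q * q) * v₁) + 2 * (w * w + q * q * x) + 2 * (w * w)
        ≡ (1 + L) * (2 * w * (2 * w)) + 2 * (q * q) * (x + 2 * (v₀ + v₁))
      collect = solve-∀

  -- Every leaf is counted at its own value, and `decode` applies to each of the `H` values. Mostly
  -- right guesses therefore require a large `H`.
  ∑-decode : ∀ {q} {F : Leaf L → ℕ} (p : Predictor q F) H → (∀ t → F t < H) →
             ∑ᴸ (λ t → 2 ^ Predictor.cor p t) ≤ H * 3 ^ L
  ∑-decode {L} {F = F} p H F<H = begin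
    ∑ᴸ (λ t → 2 ^ cor t)                                        ≤⟨ ∑-mono (covered ∘ dec) ⟩
    ∑ᴸ (λ t → ∑ λ (h : Fin H) → 𝟙 (F t ≟ toℕ h) * 2 ^ cor t)    ≡⟨ ∑-comm (λ x (h : Fin H) → 𝟙 (F (dec x) ≟ toℕ h) * 2 ^ cor (dec x)) ⟩
    (∑ λ (h : Fin H) → ∑ᴸ (λ t → 𝟙 (F t ≟ toℕ h) * 2 ^ cor t))  ≤⟨ ∑-≤ {H} (λ h → decode (toℕ h)) ⟩
    H * 3 ^ L                                                  ∎
    where
    open ≤-Reasoning
    open Predictor p
    covered : ∀ t → 2 ^ cor t ≤ ∑ λ (h : Fin H) → 𝟙 (F t ≟ toℕ h) * 2 ^ cor t
    covered t = ≤-trans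
      (≤-reflexive (sym (trans (cong (_* 2 ^ cor t) (𝟙-true (F t ≟ _) (sym (Fin.toℕ-fromℕ< (F<H t))))) (*-identityˡ _))))
      (term≤∑ (λ h → 𝟙 (F t ≟ toℕ h) * 2 ^ cor t) (fromℕ< (F<H t)))

  -- Hitting all large certificates with boundedly many draws.

  ∏<1 : (f : Fin n → ℕ) → ∏ f < 1 → ∃[ i ] f i ≡ 0
  ∏<1 {zero}  f (s≤s ())
  ∏<1 {suc n} f lt with m*n≡0⇒m≡0∨n≡0 (f zero) (n<1⇒n≡0 lt)
  ... | inj₁ eq = zero , eq
  ... | inj₂ eq = let i , fi≡0 = ∏<1 (f ∘ suc) (≤-reflexive (cong suc eq)) in suc i , fi≡0

  -- This is (1 - 1 / K) ^ K ≤ 1 / 2 for K = 1 + κ, by Bernoulli's inequality with exponent K.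
  ^-≤-half : ∀ κ .{{_ : NonZero κ}} → 2 * κ ^ suc κ ≤ suc κ ^ suc κ
  ^-≤-half κ = *-cancelʳ-≤ _ _ κ (begin
    2 * κ ^ suc κ * κ               ≡⟨ reorder κ (κ ^ suc κ) ⟩
    κ ^ suc κ * (κ + κ)             ≤⟨ *-monoʳ-≤ (κ ^ suc κ) (+-monoʳ-≤ κ (n≤1+n κ)) ⟩
    κ ^ suc κ * (κ + suc κ)         ≤⟨ bernoulli κ (suc κ) ⟩
    suc κ ^ suc κ * κ               ∎)
    where
    open ≤-Reasoning
    reorder : ∀ κ x → 2 * x * κ ≡ x * (κ + κ)
    reorder = solve-∀

  ^-distribʳ-* : ∀ n x y → (x * y) ^ n ≡ x ^ n * y ^ n
  ^-distribʳ-* zero    x y = refl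
  ^-distribʳ-* (suc n) x y =
    trans (cong (x * y *_) (^-distribʳ-* n x y)) ([m*n]*[o*p]≡[m*o]*[n*p] x y (x ^ n) (y ^ n))

  ^-≤-2^ : ∀ κ .{{_ : NonZero κ}} j {k} → suc κ * j ≤ k → 2 ^ j * κ ^ k ≤ suc κ ^ k
  ^-≤-2^ κ j {k} Kj≤k = begin
    2 ^ j * κ ^ k                          ≡⟨ cong (λ k → 2 ^ j * κ ^ k) k≡ ⟨
    2 ^ j * κ ^ (K * j + d)                ≡⟨ cong (2 ^ j *_) (^-distribˡ-+-* κ (K * j) d) ⟩
    2 ^ j * (κ ^ (K * j) * κ ^ d)          ≡⟨ *-assoc (2 ^ j) _ _ ⟨
    2 ^ j * κ ^ (K * j) * κ ^ d            ≡⟨ cong (λ x → 2 ^ j * x * κ ^ d) (^-*-assoc κ K j) ⟨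
    2 ^ j * (κ ^ K) ^ j * κ ^ d            ≡⟨ cong (_* κ ^ d) (^-distribʳ-* j 2 (κ ^ K)) ⟨
    (2 * κ ^ K) ^ j * κ ^ d                ≤⟨ *-mono-≤ (^-monoˡ-≤ j (^-≤-half κ)) (^-monoˡ-≤ d (n≤1+n κ)) ⟩
    (K ^ K) ^ j * K ^ d                    ≡⟨ cong (_* K ^ d) (^-*-assoc K K j) ⟩
    K ^ (K * j) * K ^ d                    ≡⟨ ^-distribˡ-+-* K (K * j) d ⟨
    K ^ (K * j + d)                        ≡⟨ cong (K ^_) k≡ ⟩
    K ^ k                                  ∎
    where
    open ≤-Reasoning
    K = suc κ
    d = k ∸ K * j
    k≡ : K * j + d ≡ k
    k≡ = m+[n∸m]≡n Kj≤k

  ∑-𝟙-¬ : {P : Fin n → Set} (P? : U.Decidable P) → ∑ (λ i → 𝟙 (¬? (P? i))) + ∑ (λ i → 𝟙 (P? i)) ≡ n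
  ∑-𝟙-¬ {n} P? = trans (sym (∑-distrib-+ (λ i → 𝟙 (¬? (P? i))) (λ i → 𝟙 (P? i))))
    (trans (∑-cong (λ i → one (P? i))) (trans (∑-const n 1) (*-identityʳ n)))
    where
    one : {A : Set} (p : Dec A) → 𝟙 (¬? p) + 𝟙 p ≡ 1
    one (yes _) = refl
    one (no _)  = refl

  -- A certificate `e` declares vertices active (`A`) and gives each of them a set `Q` of draws, of
  -- density at least 1 / K. The aim is a fixed choice of draws that meets some such set for every
  -- certificate with many active vertices.
  module Hitting {N r c : ℕ} (κ : ℕ) .{{κ≢0 : NonZero κ}} .{{r≢0 : NonZero r}} (1≤N : 1 ≤ N) (c≤ : c ≤ 2 ^ (3 * N))
    {A : Fin c → Fin N → Set} (A? : Decidable A)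
    {Q : Fin c → Fin N → Fin r → Set} (Q? : ∀ e w → U.Decidable (Q e w))
    (dense : ∀ e w → A e w → r ≤ suc κ * ∑ (λ ω → 𝟙 (Q? e w ω)))
    where

    private
      -- 4 K N draws are made by the N / 2 K² or more active vertices of a large certificate; all of them
      -- miss with probability (1 - 1 / K) ^ (4 K N) ≤ 2 ^ (- 4 N), against 2 ^ (3 N) certificates.
      K D : ℕ
      K = suc κ
      D = 8 * (K * K * K)

      active : Fin c → ℕ
      active e = ∑ (λ w → 𝟙 (A? e w))

      Large : Fin c → Set
      Large e = N ≤ 2 * (K * K) * active e

      Large? : U.Decidable Large
      Large? e = N ≤? 2 * (K * K) * active e

      Hit? : ∀ e w ω → Dec (A e w × Q e w ω)
      Hit? e w ω = A? e w ×-dec Q? e w ω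

      miss : Fin c → Fin (N * D) → Fin r → ℕ
      miss e x ω = 𝟙 (¬? (Hit? e (quotient D x) ω))

      -- The number of choices of all draws under which `e` is never hit.
      misses : Fin c → ℕ
      misses e = ∏ (λ x → ∑ (miss e x))

      few : ∀ e w → A e w → K * ∑ (λ ω → 𝟙 (¬? (Hit? e w ω))) ≤ κ * r
      few e w a = +-cancelʳ-≤ r _ _ (begin
        K * x + r              ≤⟨ +-monoʳ-≤ (K * x) (≤-trans (dense e w a) (*-monoʳ-≤ K
                                    (∑-mono λ ω → 𝟙-mono (Q? e w ω) (Hit? e w ω) (a ,_)))) ⟩
        K * x + K * y          ≡⟨ *-distribˡ-+ K x y ⟨
        K * (x + y)            ≡⟨ cong (K *_) (∑-𝟙-¬ (Hit? e w)) ⟩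
        K * r                  ≡⟨ +-comm r (κ * r) ⟩
        κ * r + r              ∎)
        where
        open ≤-Reasoning
        x = ∑ (λ ω → 𝟙 (¬? (Hit? e w ω)))
        y = ∑ (λ ω → 𝟙 (Hit? e w ω))

      draws : ∀ e → ∑ (λ x → 𝟙 (A? e (quotient {N} D x))) ≡ D * active e
      draws e = trans (∑-combine {D} N _) (trans
        (∑-cong λ w → trans
          (∑-cong λ (i : Fin D) → cong (λ p → 𝟙 (A? e (proj₁ p))) (Fin.remQuot-combine {N} {D} w i))
          (∑-const D _))
        (sym (*-distribˡ-sum D (λ w → 𝟙 (A? e w)))))

      misses-bound : ∀ e → Large e → 2 ^ (4 * N) * misses e ≤ r ^ (N * D)
      misses-bound e large = *-cancelʳ-≤ _ _ (K ^ k) {{m^n≢0 K k}} (begin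
        2 ^ (4 * N) * misses e * K ^ k          ≡⟨ reorder (2 ^ (4 * N)) (misses e) (K ^ k) ⟩
        2 ^ (4 * N) * (K ^ k * misses e)        ≤⟨ *-monoʳ-≤ (2 ^ (4 * N)) (∏-bound κ (λ x → ∑ (miss e x)) (λ x → A? e (quotient D x))
                                                     (λ x → ≤-trans (∑-≤ {x = 1} (λ ω → 𝟙≤1 (¬? (Hit? e (quotient {N} D x) ω)))) (≤-reflexive (*-identityʳ r)))
                                                     (λ x → few e (quotient D x))) ⟩
        2 ^ (4 * N) * (κ ^ k * r ^ (N * D))     ≡⟨ *-assoc (2 ^ (4 * N)) _ _ ⟨
        2 ^ (4 * N) * κ ^ k * r ^ (N * D)       ≤⟨ *-monoˡ-≤ (r ^ (N * D)) (^-≤-2^ κ (4 * N) enough) ⟩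
        K ^ k * r ^ (N * D)                     ≡⟨ *-comm (K ^ k) _ ⟩
        r ^ (N * D) * K ^ k                     ∎)
        where
        open ≤-Reasoning
        k = ∑ (λ x → 𝟙 (A? e (quotient {N} D x)))
        reorder : ∀ x y z → x * y * z ≡ x * (z * y)
        reorder = solve-∀
        enough : K * (4 * N) ≤ k
        enough = begin
          K * (4 * N)                               ≤⟨ *-monoʳ-≤ K (*-monoʳ-≤ 4 large) ⟩
          K * (4 * (2 * (K * K) * active e))        ≡⟨ regroup K (active e) ⟩
          8 * (K * K * K) * active e                ≡⟨ draws e ⟨
          k                                         ∎
          where
          regroup : ∀ K a → K * (4 * (2 * (K * K) * a)) ≡ 8 * (K * K * K) * a
          regroup = solve-∀

      -- Divided by r ^ (N * D), this is the mean number of large certificates that uniform draws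
      -- fail to hit.
      weight : ℕ
      weight = ∑ (λ e → 𝟙 (Large? e) * misses e)

      weight-bound : weight < r ^ (N * D)
      weight-bound = ≰⇒> λ le → <⇒≱ (^-monoʳ-< 2 (s≤s (s≤s z≤n)) (*-monoˡ-< N {{>-nonZero 1≤N}} (n<1+n 3)))
        (*-cancelʳ-≤ _ _ (r ^ (N * D)) {{m^n≢0 r (N * D)}} (begin
          2 ^ (4 * N) * r ^ (N * D)                                ≤⟨ *-monoʳ-≤ (2 ^ (4 * N)) le ⟩
          2 ^ (4 * N) * weight                                     ≡⟨ *-distribˡ-sum (2 ^ (4 * N)) (λ e → 𝟙 (Large? e) * misses e) ⟩
          ∑ (λ e → 2 ^ (4 * N) * (𝟙 (Large? e) * misses e))        ≤⟨ ∑-≤ bound ⟩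
          c * r ^ (N * D)                                          ≤⟨ *-monoˡ-≤ (r ^ (N * D)) c≤ ⟩
          2 ^ (3 * N) * r ^ (N * D)                                ∎))
        where
        open ≤-Reasoning
        bound : ∀ e → 2 ^ (4 * N) * (𝟙 (Large? e) * misses e) ≤ r ^ (N * D)
        bound e = by (Large? e)
          where
          by : (p : Dec (Large e)) → 2 ^ (4 * N) * (𝟙 p * misses e) ≤ r ^ (N * D)
          by (yes p) = ≤-trans (≤-reflexive (cong (2 ^ (4 * N) *_) (*-identityˡ _))) (misses-bound e p)
          by (no _)  = ≤-trans (≤-reflexive (*-zeroʳ (2 ^ (4 * N)))) z≤n

    hitting : ∃ λ (g : Fin N → Fin D → Fin r) →
              ∀ e → N ≤ 2 * (K * K) * ∑ (λ w → 𝟙 (A? e w)) → ∃[ w ] ∃[ i ] A e w × Q e w (g w i)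
    hitting = let g , lt = derandomize (N * D) (λ e → 𝟙 (Large? e)) miss weight-bound in
      (λ w i → g (combine w i)) , λ e large →
        -- After derandomization the total is below 1, so the product for a large `e` vanishes, and
        -- a vanishing factor is a hit.
        let fx<1 = ≤-<-trans (≤-trans (≤-reflexive (sym (trans
                     (cong (_* ∏ (λ x → miss e x (g x))) (𝟙-true (Large? e) large)) (*-identityˡ _))))
                     (term≤∑ (λ e → 𝟙 (Large? e) * ∏ (λ x → miss e x (g x))) e)) lt
            x , eq = ∏<1 (λ x → miss e x (g x)) fx<1
            w , i  = remQuot {N} D x
            a , q  = decidable-stable (Hit? e w (g x)) (λ ¬hit → 1+n≢0 (trans (sym (𝟙-true (¬? (Hit? e w (g x))) ¬hit)) eq))
        in w , i , a , subst (λ x → Q e w (g x)) (sym (Fin.combine-remQuot {N} D x)) q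

  -- Codes of certificates, positions of vertices, and draws.

  decode-set : Fin (2 ^ n) → Fin n → Set
  decode-set {n} e i = finToFun {2} {n} e i ≡ 1F

  decode-set? : (e : Fin (2 ^ n)) → U.Decidable (decode-set {n} e)
  decode-set? {n} e i = finToFun {2} {n} e i Fin.≟ 1F

  encode-set : {P : Fin n → Set} → U.Decidable P → Fin (2 ^ n)
  encode-set P? = funToFin (λ i → if does (P? i) then 1F else 0F)

  module _ {P : Fin n → Set} (P? : U.Decidable P) where

    encode-sound : ∀ {i} → decode-set (encode-set P?) i → P i
    encode-sound {i} eq = sound (P? i) (trans (sym (Fin.finToFun-funToFin _ i)) eq)
      where
      sound : ∀ {A : Set} (p : Dec A) → (Fin 2 ∋ (if does p then 1F else 0F)) ≡ 1F → A
      sound (yes a) _ = a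
    encode-complete : ∀ {i} → P i → decode-set (encode-set P?) i
    encode-complete {i} Pi = trans (Fin.finToFun-funToFin _ i) (complete (P? i) Pi)
      where
      complete : ∀ {A : Set} (p : Dec A) → A → (Fin 2 ∋ (if does p then 1F else 0F)) ≡ 1F
      complete (yes _) _ = refl
      complete (no ¬a) a = contradiction a ¬a

  enc-dec : (x : Fin (2 ^ L)) → enc (dec {L} x) ≡ x
  enc-dec {zero}  zero = refl
  enc-dec {suc L} x    = trans
    (cong (combine {2} {2 ^ L} (proj₁ (remQuot {2} (2 ^ L) x))) (enc-dec {L} (proj₂ (remQuot {2} (2 ^ L) x))))
    (Fin.combine-remQuot {2} (2 ^ L) x)

  -- For independent uniform `t` and `u` every bit of `mix s t u` is a uniform bit of one of them,
  -- so the mixture is uniform. Hence few draws lead into a small set.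
  ∑ᴸ-mix : (s : Fin L) (φ : Leaf L → ℕ) → ∑ᴸ (λ t → ∑ᴸ (λ u → φ (mix s t u))) ≡ 2 ^ L * ∑ᴸ φ
  ∑ᴸ-mix {L}     zero    φ = ∑-const (2 ^ L) (∑ᴸ φ)
  ∑ᴸ-mix {suc L} (suc s) φ = begin
    ∑ᴸ (λ t → ∑ᴸ (λ u → φ (mix (suc s) t u)))
      ≡⟨ ∑ᴸ-suc (λ t → ∑ᴸ (λ u → φ (mix (suc s) t u))) ⟩
    ∑ᴸ (λ t → ∑ᴸ (λ u → φ (mix (suc s) (0F ∷ t) u))) + ∑ᴸ (λ t → ∑ᴸ (λ u → φ (mix (suc s) (1F ∷ t) u)))
      ≡⟨ cong₂ _+_ (side 0F) (side 1F) ⟩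
    2 ^ suc L * ∑ᴸ (φ ∘ (0F ∷_)) + 2 ^ suc L * ∑ᴸ (φ ∘ (1F ∷_))
      ≡⟨ *-distribˡ-+ (2 ^ suc L) (∑ᴸ (φ ∘ (0F ∷_))) _ ⟨
    2 ^ suc L * (∑ᴸ (φ ∘ (0F ∷_)) + ∑ᴸ (φ ∘ (1F ∷_)))
      ≡⟨ cong (2 ^ suc L *_) (∑ᴸ-suc φ) ⟨
    2 ^ suc L * ∑ᴸ φ ∎
    where
    open ≡-Reasoning
    double : ∀ x → x + x ≡ 2 * x
    double = solve-∀
    side : ∀ b → ∑ᴸ (λ t → ∑ᴸ (λ u → φ (mix (suc s) (b ∷ t) u))) ≡ 2 ^ suc L * ∑ᴸ (φ ∘ (b ∷_))
    side b = begin
      ∑ᴸ (λ t → ∑ᴸ (λ u → φ (mix (suc s) (b ∷ t) u)))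
        ≡⟨ ∑-cong (λ x → trans (∑ᴸ-suc (λ u → φ (mix (suc s) (b ∷ dec x) u))) (double (∑ᴸ (λ u → φ (b ∷ mix s (dec x) u))))) ⟩
      ∑ᴸ (λ t → 2 * ∑ᴸ (λ u → φ (b ∷ mix s t u)))
        ≡⟨ *-distribˡ-sum 2 (λ x → ∑ᴸ (λ u → φ (b ∷ mix s (dec x) u))) ⟨
      2 * ∑ᴸ (λ t → ∑ᴸ (λ u → φ (b ∷ mix s t u)))
        ≡⟨ cong (2 *_) (∑ᴸ-mix s (φ ∘ (b ∷_))) ⟩
      2 * (2 ^ L * ∑ᴸ (φ ∘ (b ∷_)))
        ≡⟨ *-assoc 2 (2 ^ L) _ ⟨
      2 ^ suc L * ∑ᴸ (φ ∘ (b ∷_)) ∎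

  -- The two leaves agree above `s`, where the bit drops from 1 to 0. This makes the network
  -- acyclic.
  mix-< : (s : Fin L) (t u : Leaf L) → Down s t u → enc (mix s t u) Data.Fin.< enc t
  mix-< {suc L} zero    (1F ∷ t) (0F ∷ u) (refl , refl) = Fin.combine-monoˡ-< {2} {2 ^ L} {0F} {1F} (enc u) (enc t) (s≤s z≤n)
  mix-< {suc L} (suc s) (b ∷ t)  (c ∷ u)  down = begin-strict
    toℕ (combine b (enc (mix s t u)))              ≡⟨ Fin.toℕ-combine b _ ⟩
    2 ^ L * toℕ b + toℕ (enc (mix s t u))          <⟨ +-monoʳ-< (2 ^ L * toℕ b) (mix-< s t u down) ⟩
    2 ^ L * toℕ b + toℕ (enc t)                    ≡⟨ Fin.toℕ-combine b (enc t) ⟨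
    toℕ (combine b (enc t))                        ∎
    where open ≤-Reasoning

  module Positions (L m : ℕ) where

    T N : ℕ
    T = 2 ^ L
    N = T * m

    leaf : Fin N → Leaf L
    leaf v = dec (quotient {T} m v)

    slot : Fin N → Fin m
    slot v = remainder {T} m v

    vtx : Leaf L → Fin m → Fin N
    vtx t j = combine (enc t) j

    leaf-vtx : ∀ t j → leaf (vtx t j) ≡ t
    leaf-vtx t j = trans (cong (dec ∘ proj₁) (Fin.remQuot-combine {T} {m} (enc t) j)) (dec-enc t)

    slot-vtx : ∀ t j → slot (vtx t j) ≡ j
    slot-vtx t j = cong proj₂ (Fin.remQuot-combine {T} {m} (enc t) j)

    vtx-leaf : ∀ v → vtx (leaf v) (slot v) ≡ v
    vtx-leaf v = trans (cong (λ x → combine x (slot v)) (enc-dec {L} (quotient {T} m v))) (Fin.combine-remQuot {T} m v)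

    ∑-vtx : (f : Fin N → ℕ) → ∑ f ≡ ∑ᴸ (λ t → ∑ (λ j → f (vtx t j)))
    ∑-vtx f = trans (∑-combine {m} T f) (∑-cong λ x → ∑-cong λ j → cong (λ y → f (combine y j)) (sym (enc-dec {L} x)))

    -- A draw ω picks a level s and a vertex, whose leaf replaces the bits of t from s on.
    Ω : ℕ
    Ω = L * N

    level : Fin Ω → Fin L
    level ω = quotient {L} N ω

    source : Fin Ω → Fin N
    source ω = remainder {L} N ω

    goal : Leaf L → Fin Ω → Leaf L
    goal t ω = mix (level ω) t (leaf (source ω))

    target : Leaf L → Fin Ω → Fin N
    target t ω = vtx (goal t ω) (slot (source ω))

    Usable : Leaf L → Fin Ω → Set
    Usable t ω = Down (level ω) t (leaf (source ω))

    Usable? : ∀ t ω → Dec (Usable t ω)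
    Usable? t ω = Down? (level ω) t (leaf (source ω))

    ∑-draws : (φ : Fin L → Leaf L → Fin m → ℕ) →
              ∑ (λ ω → φ (level ω) (leaf (source ω)) (slot (source ω))) ≡ ∑ (λ s → ∑ᴸ (λ u → ∑ (φ s u)))
    ∑-draws φ = begin
      ∑ (λ ω → φ (level ω) (leaf (source ω)) (slot (source ω)))
        ≡⟨ ∑-combine {N} L (λ ω → φ (level ω) (leaf (source ω)) (slot (source ω))) ⟩
      ∑ (λ (s : Fin L) → ∑ (λ (v : Fin N) → φ (level (combine s v)) (leaf (source (combine s v))) (slot (source (combine s v)))))
        ≡⟨ (∑-cong {L} λ s → ∑-cong {N} λ v → cong (λ (s , v) → φ s (leaf v) (slot v)) (Fin.remQuot-combine {L} {N} s v)) ⟩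
      ∑ (λ s → ∑ (λ v → φ s (leaf v) (slot v)))
        ≡⟨ (∑-cong λ s → trans (∑-vtx (λ v → φ s (leaf v) (slot v)))
             (∑-cong λ x → ∑-cong λ j → cong₂ (φ s) (leaf-vtx (dec x) j) (slot-vtx (dec x) j))) ⟩
      ∑ (λ s → ∑ᴸ (λ u → ∑ (φ s u))) ∎
      where open ≡-Reasoning

    -- The draws that a certificate forbids to its active vertices; `¬late` shows that none is made
    -- for the `W`, `Z` and `F` obtained from a set `S`.
    Late : (Fin N → Set) → (Leaf L → ℕ) → Leaf L → Fin Ω → Set
    Late Z F t ω = Usable t ω × ¬ Z (target t ω) × F t ≤ F (goal t ω)

    Late? : {Z : Fin N → Set} → U.Decidable Z → (F : Leaf L → ℕ) → ∀ t → U.Decidable (Late Z F t)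
    Late? Z? F t ω = Usable? t ω ×-dec ¬? (Z? (target t ω)) ×-dec (F t ≤? F (goal t ω))

    lates : {Z : Fin N → Set} → U.Decidable Z → (Leaf L → ℕ) → Leaf L → ℕ
    lates Z? F t = ∑ (λ ω → 𝟙 (Late? Z? F t ω))

  module Random (L m κ : ℕ) .{{_ : NonZero L}} .{{_ : NonZero m}} .{{_ : NonZero κ}} where

    open Positions L m

    K D H : ℕ
    K = suc κ
    D = 8 * (K * K * K)
    -- Values below 2 ^ m on T leaves take T m = N bits, as many as a set of vertices.
    H = 2 ^ m

    instance
      T≢0 : NonZero T
      T≢0 = m^n≢0 2 L
      N≢0 : NonZero N
      N≢0 = m*n≢0 T m
      Ω≢0 : NonZero Ω
      Ω≢0 = m*n≢0 L N

    -- The density 1 / K of forbidden draws that `Hitting` asks for.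
    Dense : {Z : Fin N → Set} → U.Decidable Z → (Leaf L → ℕ) → Leaf L → Set
    Dense Z? F t = Ω ≤ K * lates Z? F t

    Dense? : {Z : Fin N → Set} (Z? : U.Decidable Z) (F : Leaf L → ℕ) → U.Decidable (Dense Z? F)
    Dense? Z? F t = Ω ≤? K * lates Z? F t

    Hits : (Fin N → Fin D → Fin Ω) → Set₁
    Hits g = {W Z : Fin N → Set} (W? : U.Decidable W) (Z? : U.Decidable Z) (F : Leaf L → ℕ) → (∀ t → F t < H) →
             N ≤ 2 * (K * K) * ∑ (λ w → 𝟙 (W? w ×-dec Dense? Z? F (leaf w))) →
             ∃[ w ] ∃[ i ] W w × Late Z F (leaf w) (g w i)

    module Certificate (e : Fin (2 ^ N * (2 ^ N * H ^ T))) where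
      eW = quotient {2 ^ N} (2 ^ N * H ^ T) e
      e′ = remainder {2 ^ N} (2 ^ N * H ^ T) e
      eZ = quotient {2 ^ N} (H ^ T) e′
      eF = remainder {2 ^ N} (H ^ T) e′
      Z? = decode-set? {N} eZ
      F : Leaf L → ℕ
      F t = toℕ (finToFun {H} {T} eF (enc t))

    certificates : 2 ^ N * (2 ^ N * H ^ T) ≤ 2 ^ (3 * N)
    certificates = ≤-reflexive (begin
      2 ^ N * (2 ^ N * (2 ^ m) ^ T)      ≡⟨ cong (λ x → 2 ^ N * (2 ^ N * x)) (trans (^-*-assoc 2 m T) (cong (2 ^_) (*-comm m T))) ⟩
      2 ^ N * (2 ^ N * 2 ^ N)            ≡⟨ cong (2 ^ N *_) (^-distribˡ-+-* 2 N N) ⟨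
      2 ^ N * 2 ^ (N + N)                ≡⟨ ^-distribˡ-+-* 2 N (N + N) ⟨
      2 ^ (N + (N + N))                  ≡⟨ cong (λ x → 2 ^ (N + (N + x))) (+-identityʳ N) ⟨
      2 ^ (3 * N)                        ∎)
      where open ≡-Reasoning

    private
      open Certificate
      module Hit = Hitting κ (>-nonZero⁻¹ N) certificates
        {A = λ e w → decode-set {N} (eW e) w × Dense (Z? e) (F e) (leaf w)}
        (λ e w → decode-set? {N} (eW e) w ×-dec Dense? (Z? e) (F e) (leaf w))
        {Q = λ e w → Late (decode-set {N} (eZ e)) (F e) (leaf w)}
        (λ e w → Late? (Z? e) (F e) (leaf w))
        (λ e w → proj₂)

    g : Fin N → Fin D → Fin Ω
    g = proj₁ Hit.hitting

    -- The data `W`, `Z`, `F` are coded as a certificate. Density is carried over to the code by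
    -- `late⇒`, and the late draw found there is carried back by `late⇐`.
    g-hits : Hits g
    g-hits {W} {Z} W? Z? F F<H large =
      let w , i , (w∈W , _) , late = proj₂ Hit.hitting e (≤-trans large (*-monoʳ-≤ (2 * (K * K)) (∑-mono λ w →
            𝟙-mono (W? w ×-dec Dense? Z? F (leaf w)) (decode-set? {N} (eW e) w ×-dec Dense? (Certificate.Z? e) (Certificate.F e) (leaf w))
              λ (Ww , dense) → encode-W Ww , ≤-trans dense (*-monoʳ-≤ K (∑-mono λ ω →
                𝟙-mono (Late? Z? F (leaf w) ω) (Late? (Certificate.Z? e) (Certificate.F e) (leaf w) ω) late⇒)))))
      in w , i , decode-W w∈W , late⇐ late
      where
      f : Fin T → Fin H
      f x = fromℕ< (F<H (dec x))
      fe = funToFin f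
      ze = encode-set Z?
      we = encode-set W?
      e = combine we (combine ze fe)
      e′≡ : remQuot {2 ^ N} (2 ^ N * H ^ T) e ≡ (we , combine ze fe)
      e′≡ = Fin.remQuot-combine {2 ^ N} we (combine ze fe)
      e″≡ : remQuot {2 ^ N} (H ^ T) (e′ e) ≡ (ze , fe)
      e″≡ = trans (cong (remQuot {2 ^ N} (H ^ T)) (cong proj₂ e′≡)) (Fin.remQuot-combine {2 ^ N} ze fe)
      F≡ : ∀ t → Certificate.F e t ≡ F t
      F≡ t = begin
        toℕ (finToFun {H} {T} (eF e) (enc t))    ≡⟨ cong (λ x → toℕ (finToFun {H} {T} x (enc t))) (cong proj₂ e″≡) ⟩
        toℕ (finToFun {H} {T} fe (enc t))        ≡⟨ cong toℕ (Fin.finToFun-funToFin f (enc t)) ⟩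
        toℕ (fromℕ< (F<H (dec (enc t))))         ≡⟨ Fin.toℕ-fromℕ< (F<H (dec (enc t))) ⟩
        F (dec (enc t))                          ≡⟨ cong F (dec-enc t) ⟩
        F t                                      ∎
        where open ≡-Reasoning
      encode-W : ∀ {w} → W w → decode-set {N} (eW e) w
      encode-W {w} Ww = subst (λ x → decode-set {N} x w) (sym (cong proj₁ e′≡)) (encode-complete W? Ww)
      decode-W : ∀ {w} → decode-set {N} (eW e) w → W w
      decode-W {w} d = encode-sound W? (subst (λ x → decode-set {N} x w) (cong proj₁ e′≡) d)
      encode-Z : ∀ {w} → Z w → decode-set {N} (eZ e) w
      encode-Z {w} Zw = subst (λ x → decode-set {N} x w) (sym (cong proj₁ e″≡)) (encode-complete Z? Zw)
      decode-Z : ∀ {w} → decode-set {N} (eZ e) w → Z w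
      decode-Z {w} d = encode-sound Z? (subst (λ x → decode-set {N} x w) (cong proj₁ e″≡) d)
      late⇒ : ∀ {t ω} → Late Z F t ω → Late (decode-set {N} (eZ e)) (Certificate.F e) t ω
      late⇒ (u , ¬z , le) = u , ¬z ∘ decode-Z , subst₂ _≤_ (sym (F≡ _)) (sym (F≡ _)) le
      late⇐ : ∀ {t ω} → Late (decode-set {N} (eZ e)) (Certificate.F e) t ω → Late Z F t ω
      late⇐ (u , ¬z , le) = u , ¬z ∘ encode-Z , subst₂ _≤_ (F≡ _) (F≡ _) le

  -- 2⁹¹ against 8·3⁵² is the margin between 2 ^ cor on typical leaves and the H · 3 ^ L allowed by decoding.
  constants : 8 * 3 ^ 52 < 2 ^ 91
  constants = <ᵇ⇒< (8 * 3 ^ 52) (2 ^ 91) tt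

  -- A function with few values has many violations.

  gap : ∀ ℓ .{{_ : NonZero ℓ}} → 2 * (2 ^ (2 * ℓ) * 3 ^ (52 * ℓ)) < 2 ^ (39 * ℓ) * 2 ^ (52 * ℓ)
  gap ℓ@(suc ℓ-1) = begin-strict
    -- As ℓ ≥ 1, the leading 2 is at most 2 ^ ℓ, after which both sides are ℓ-th powers.
    2 * (2 ^ (2 * ℓ) * 3 ^ (52 * ℓ))         ≤⟨ *-monoˡ-≤ _ (^-monoʳ-≤ 2 {1} {ℓ} (s≤s z≤n)) ⟩
    2 ^ ℓ * (2 ^ (2 * ℓ) * 3 ^ (52 * ℓ))     ≡⟨ cong (2 ^ ℓ *_) (cong₂ _*_ (^-*-assoc 2 2 ℓ) (^-*-assoc 3 52 ℓ)) ⟨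
    2 ^ ℓ * (4 ^ ℓ * (3 ^ 52) ^ ℓ)           ≡⟨ cong (2 ^ ℓ *_) (^-distribʳ-* ℓ 4 (3 ^ 52)) ⟨
    2 ^ ℓ * (4 * 3 ^ 52) ^ ℓ                 ≡⟨ ^-distribʳ-* ℓ 2 (4 * 3 ^ 52) ⟨
    (8 * 3 ^ 52) ^ ℓ                         <⟨ ^-monoˡ-< ℓ constants ⟩
    (2 ^ 91) ^ ℓ                             ≡⟨ ^-distribʳ-* ℓ (2 ^ 39) (2 ^ 52) ⟩
    (2 ^ 39) ^ ℓ * (2 ^ 52) ^ ℓ              ≡⟨ cong₂ _*_ (^-*-assoc 2 39 ℓ) (^-*-assoc 2 52 ℓ) ⟩
    2 ^ (39 * ℓ) * 2 ^ (52 * ℓ)              ∎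
    where open ≤-Reasoning

  module _ (ℓ : ℕ) .{{_ : NonZero ℓ}} (F : Leaf (52 * ℓ) → ℕ) (F<H : ∀ t → F t < 2 ^ (2 * ℓ)) where

    private
      p = predictor 16 (s≤s (s≤s z≤n)) F
      open Predictor p
      T a y M S : ℕ
      T = 2 ^ (52 * ℓ)
      -- With L = 52 ℓ these are a = L / 4 and y = 2 ^ (3 L / 4).
      a = 13 * ℓ
      y = 2 ^ (39 * ℓ)
      M = ∑ᴸ mis
      S = ∑ᴸ (λ t → 2 ^ cor t)

      -- Markov's inequality leaf by leaf: either at least L / 4 guesses are wrong, or at least 3 L
      -- / 4 are right and 2 ^ `cor` is at least `y`.
      tradeoff : ∀ t → a * y ≤ a * 2 ^ cor t + y * mis t
      tradeoff t with a ≤? mis t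
      ... | yes a≤mis = ≤-trans (≤-trans (≤-reflexive (*-comm a y)) (*-monoʳ-≤ y a≤mis)) (m≤n+m _ (a * 2 ^ cor t))
      ... | no  a≰mis = ≤-trans (*-monoʳ-≤ a (^-monoʳ-≤ 2 39ℓ≤cor)) (m≤m+n _ (y * mis t))
        where
        split : ∀ ℓ → 13 * ℓ + 39 * ℓ ≡ 52 * ℓ
        split = solve-∀
        39ℓ≤cor : 39 * ℓ ≤ cor t
        39ℓ≤cor = +-cancelˡ-≤ a _ _ (≤-trans (≤-reflexive (trans (split ℓ) (sym (mis+cor t))))
          (+-monoˡ-≤ (cor t) (<⇒≤ (≰⇒> a≰mis))))

      total : T * (a * y) ≤ a * S + y * M
      total = begin
        T * (a * y)                                                   ≡⟨ ∑-const T (a * y) ⟨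
        ∑ {T} (λ _ → a * y)                                           ≤⟨ ∑-mono (λ x → tradeoff (dec x)) ⟩
        ∑ᴸ (λ t → a * 2 ^ cor t + y * mis t)                          ≡⟨ ∑-distrib-+ (λ x → a * 2 ^ cor (dec x)) (λ x → y * mis (dec x)) ⟩
        ∑ᴸ (λ t → a * 2 ^ cor t) + ∑ᴸ (λ t → y * mis t)               ≡⟨ cong₂ _+_ (*-distribˡ-sum a (λ x → 2 ^ cor (dec x))) (*-distribˡ-sum y (mis ∘ dec)) ⟨
        a * S + y * M                                                 ∎
        where open ≤-Reasoning

    -- Otherwise, for q = 16, both terms L / q and 2 q v of the bound on the mean of `mis` are at
    -- most L / 16, so the mean is at most L / 8. By `total`, S is then at least y T / 2, whereas
    -- `∑-decode` bounds it by 2 ^ (2 ℓ) 3 ^ L, against `gap`.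
    violations-large : 52 * ℓ * (T * T) < 512 * violations F
    violations-large = ≰⇒> λ few → <⇒≱ (gap ℓ) (≤-trans (main (8M≤ few)) (*-monoʳ-≤ 2 (∑-decode p _ F<H)))
      where
      open ≤-Reasoning
      instance T≢0 = m^n≢0 2 (52 * ℓ)
      8M≤ : 512 * violations F ≤ 52 * ℓ * (T * T) → 8 * M ≤ 52 * ℓ * T
      8M≤ few = *-cancelʳ-≤ _ _ T (*-cancelˡ-≤ 2 (begin
        2 * (8 * M * T)                                  ≡⟨ e₁ M T ⟩
        16 * (T * M)                                     ≤⟨ mis-rare ⟩
        52 * ℓ * (T * T) + 512 * violations F            ≤⟨ +-monoʳ-≤ (52 * ℓ * (T * T)) few ⟩
        52 * ℓ * (T * T) + 52 * ℓ * (T * T)              ≡⟨ e₂ (52 * ℓ) T ⟩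
        2 * (52 * ℓ * T * T)                             ∎))
        where
        e₁ : ∀ M T → 2 * (8 * M * T) ≡ 16 * (T * M)
        e₁ = solve-∀
        e₂ : ∀ L T → L * (T * T) + L * (T * T) ≡ 2 * (L * T * T)
        e₂ = solve-∀
      main : 8 * M ≤ 52 * ℓ * T → y * T ≤ 2 * S
      main 8M≤ = *-cancelˡ-≤ (52 * ℓ) {{m*n≢0 52 ℓ}} (+-cancelʳ-≤ (y * (52 * ℓ * T)) _ _ (begin
        52 * ℓ * (y * T) + y * (52 * ℓ * T)      ≡⟨ e₁ ℓ y T ⟩
        8 * (T * (13 * ℓ * y))                   ≤⟨ *-monoʳ-≤ 8 total ⟩
        8 * (13 * ℓ * S + y * M)                 ≡⟨ e₂ ℓ S y M ⟩
        52 * ℓ * (2 * S) + y * (8 * M)           ≤⟨ +-monoʳ-≤ (52 * ℓ * (2 * S)) (*-monoʳ-≤ y 8M≤) ⟩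
        52 * ℓ * (2 * S) + y * (52 * ℓ * T)      ∎))
        where
        e₁ : ∀ ℓ y T → 52 * ℓ * (y * T) + y * (52 * ℓ * T) ≡ 8 * (T * (13 * ℓ * y))
        e₁ = solve-∀
        e₂ : ∀ ℓ S y M → 8 * (13 * ℓ * S + y * M) ≡ 52 * ℓ * (2 * S) + y * (8 * M)
        e₂ = solve-∀

  -- The network and its degrees.

  module Network (L m κ : ℕ) .{{L≢0 : NonZero L}} .{{m≢0 : NonZero m}} .{{κ≢0 : NonZero κ}} where

    open Positions L m
    open Random L m κ using (K; D; H; T≢0; N≢0; Ω≢0; Dense; Dense?; Hits)

    module WithDraws (g : Fin N → Fin D → Fin Ω) where

      Arrow : Fin N → Fin N → Fin D → Set
      Arrow w v i = Usable (leaf w) (g w i) × v ≡ target (leaf w) (g w i)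

      Arrow? : ∀ w v i → Dec (Arrow w v i)
      Arrow? w v i = Usable? (leaf w) (g w i) ×-dec (v Fin.≟ target (leaf w) (g w i))

      load : Fin N → ℕ
      load v = ∑ (λ w → ∑ (λ i → 𝟙 (Arrow? w v i)))

      Light : Fin N → Set
      Light v = load v ≤ K * D

      Light? : U.Decidable Light
      Light? v = load v ≤? K * D

      E : Fin N → Fin N → Set
      E w v = Light v × ∃[ i ] Arrow w v i

      E? : Decidable E
      E? w v = Light? v ×-dec Fin.any? (Arrow? w v)

      E⇒> : ∀ {w v} → E w v → toℕ v < toℕ w
      E⇒> {w} (_ , i , usable , refl) = subst (target (leaf w) ω Data.Fin.<_) (vtx-leaf w)
        (Fin.combine-monoˡ-< (slot (source ω)) (slot w) (mix-< (level ω) (leaf w) (leaf (source ω)) usable))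
        where ω = g w i

      graph : Graph
      graph = record
        { ∣V∣ = N ; E = E ; E? = E? ; loopless = λ v e → <-irrefl refl (E⇒> e) }

      open Graph graph using (V; inDegree; outDegree; degree; IsSimplePath)

      last≤head : ∀ {n} (xs : Vec V (suc n)) → Linked E xs → toℕ (last xs) ≤ toℕ (head xs)
      last≤head (x ∷ [])     [-]      = ≤-refl
      last≤head (x ∷ y ∷ xs) (e ∷ es) = ≤-trans (last≤head (y ∷ xs) es) (<⇒≤ (E⇒> e))

      dag : DAG
      dag = record
        { graph = graph
        ; acyclic = λ xs ((_ , linked) , e) → <⇒≱ (E⇒> e) (last≤head xs linked) }

      below : ∀ {n x} {xs : Vec V n} → Linked E (x ∷ xs) → All (λ y → toℕ y < toℕ x) xs
      below {xs = []} [-] = []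
      below {xs = y ∷ ys} (e ∷ es) = E⇒> e ∷ All.map (λ lt → <-trans lt (E⇒> e)) (below es)

      -- Codes decrease along arrows, so every directed path is simple. A vertex can therefore be
      -- put in front of a path without further checks.
      linked⇒unique : ∀ {n} {xs : Vec V n} → Linked E xs → Unique xs
      linked⇒unique []  = []
      linked⇒unique [-] = [] ∷ []
      linked⇒unique (e ∷ es) = All.map (λ lt eq → <-irrefl (cong toℕ (sym eq)) lt) (below (e ∷ es)) ∷ linked⇒unique es

      E≤arrows : ∀ w v → 𝟙 (E? w v) ≤ ∑ (λ i → 𝟙 (Arrow? w v i))
      E≤arrows w v = by (E? w v)
        where
        by : (e : Dec (E w v)) → 𝟙 e ≤ ∑ (λ i → 𝟙 (Arrow? w v i))
        by (no _) = z≤n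
        by (yes (_ , i , a)) = ≤-trans (≤-reflexive (sym (𝟙-true (Arrow? w v i) a))) (term≤∑ (λ i → 𝟙 (Arrow? w v i)) i)

      outArrows≤ : ∀ w → ∑ (λ v → ∑ (λ i → 𝟙 (Arrow? w v i))) ≤ D
      outArrows≤ w = begin
        ∑ (λ v → ∑ (λ i → 𝟙 (Arrow? w v i)))     ≡⟨ ∑-comm (λ v i → 𝟙 (Arrow? w v i)) ⟩
        ∑ (λ i → ∑ (λ v → 𝟙 (Arrow? w v i)))     ≤⟨ ∑-≤ {D} (λ i → ≤-trans
                                                      (∑-mono λ v → 𝟙-mono (Arrow? w v i) (v Fin.≟ target (leaf w) (g w i)) proj₂)
                                                      (∑-𝟙-≡ (target (leaf w) (g w i)))) ⟩
        D * 1                                    ≡⟨ *-identityʳ D ⟩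
        D                                        ∎
        where open ≤-Reasoning

      outDegree≤ : ∀ w → outDegree w ≤ D
      outDegree≤ w = ≤-trans (≤-reflexive (count-tabulate (E? w) id)) (≤-trans (∑-mono (E≤arrows w)) (outArrows≤ w))

      inDegree≤ : ∀ v → inDegree v ≤ K * D
      inDegree≤ v = ≤-trans (≤-reflexive (count-tabulate (λ w → E? w v) id)) (by (Light? v))
        where
        by : Dec (Light v) → ∑ (λ w → 𝟙 (E? w v)) ≤ K * D
        by (yes light) = ≤-trans (∑-mono (λ w → E≤arrows w v)) light
        by (no heavy)  = ≤-trans (∑-mono (λ w → ≤-reflexive (𝟙-false (E? w v) (heavy ∘ proj₁))))
                           (≤-trans (≤-reflexive (∑-zero {N})) z≤n)

      -- Markov's inequality: there are at most N D arrows in all, and a heavy vertex receives more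
      -- than K D of them.
      heavy-rare : K * ∑ (λ v → 𝟙 (¬? (Light? v))) ≤ N
      heavy-rare = *-cancelʳ-≤ _ _ D (begin
        K * h * D                                    ≡⟨ reorder K h D ⟩
        K * D * h                                    ≡⟨ *-distribˡ-sum (K * D) (λ v → 𝟙 (¬? (Light? v))) ⟩
        ∑ (λ v → K * D * 𝟙 (¬? (Light? v)))          ≤⟨ ∑-mono (λ v → by v (Light? v)) ⟩
        ∑ load                                       ≡⟨ ∑-comm (λ v w → ∑ (λ i → 𝟙 (Arrow? w v i))) ⟩
        ∑ (λ w → ∑ (λ v → ∑ (λ i → 𝟙 (Arrow? w v i))))   ≤⟨ ∑-≤ outArrows≤ ⟩
        N * D                                        ∎)
        where
        open ≤-Reasoning
        h = ∑ (λ v → 𝟙 (¬? (Light? v)))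
        reorder : ∀ K h D → K * h * D ≡ K * D * h
        reorder = solve-∀
        by : ∀ v (p : Dec (Light v)) → K * D * 𝟙 (¬? p) ≤ load v
        by v (yes _) = ≤-trans (≤-reflexive (*-zeroʳ (K * D))) z≤n
        by v (no ¬p) = ≤-trans (≤-reflexive (*-identityʳ (K * D))) (<⇒≤ (≰⇒> ¬p))

      -- Lengths of paths outside a set.

      module Descent {S : Subset N} (S⊂V : S ⊂ ⊤) where

        d : ℕ
        d = codepth graph S S⊂V

        Live : ∀ {n} → Vec V (suc n) → Set
        Live xs = IsSimplePath xs × All (_∉ S) xs

        PathFrom : V → ℕ → Set
        PathFrom w k = k ≡ 0 ⊎ ∃ λ (xs : Vec V k) → Live (w ∷ xs)

        pathFrom? : ∀ w → U.Decidable (PathFrom w)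
        pathFrom? w k = (k ≟ 0) ⊎-dec anyVec? λ xs →
          (allPairs? (λ u v → ¬? (u Fin.≟ v)) (w ∷ xs) ×-dec linked? E? (w ∷ xs)) ×-dec all? (λ v → ¬? (v ∈? S)) (w ∷ xs)

        pathFrom≤ : ∀ w {k} → PathFrom w k → k ≤ d
        pathFrom≤ w (inj₁ refl)     = z≤n
        pathFrom≤ w (inj₂ (xs , p)) = proj₂ (proj₂ (longestPath graph S⊂V)) (w ∷ xs , p)

        longest : ∀ w → ∃ (IsMaximum (PathFrom w))
        longest w = maximum (pathFrom? w) (0 , inj₁ refl) d (pathFrom≤ w)

        f : V → ℕ
        f w = proj₁ (longest w)

        f≤d : ∀ w → f w ≤ d
        f≤d w = pathFrom≤ w (proj₁ (proj₂ (longest w)))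

        f-descends : ∀ {w v} → E w v → w ∉ S → v ∉ S → f v < f w
        f-descends {w} {v} e w∉S v∉S = proj₂ (proj₂ (longest w)) (extend (proj₁ (proj₂ (longest v))))
          where
          extend : ∀ {k} → PathFrom v k → PathFrom w (suc k)
          extend (inj₁ refl) = inj₂ (v ∷ [] , (linked⇒unique es , es) , w∉S ∷ v∉S ∷ [])
            where
            es : Linked E (w ∷ v ∷ [])
            es = e ∷ [-]
          extend (inj₂ (xs , (_ , linked) , avoid)) = inj₂ (v ∷ xs , (linked⇒unique es , es) , w∉S ∷ avoid)
            where
            es : Linked E (w ∷ v ∷ xs)
            es = e ∷ linked

      -- Few violations if the set is small and all paths outside it are short.

      module Levels (hits : Hits g) (S : Subset N) (small : 2 * (K * K) * ∣ S ∣ ≤ N)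
                    (f : Fin N → ℕ) (f<H : ∀ v → f v < H)
                    (f-descends : ∀ {w v} → E w v → w ∉ S → v ∉ S → f v < f w) where

        k : ℕ
        k = m / K

        k<m : k < m
        k<m = m/n<m m K (s≤s (>-nonZero⁻¹ κ))

        quantiles : ∀ t → ∃[ a ] a < H × ∑ (λ j → 𝟙 (f (vtx t j) <? a)) ≤ k × k < ∑ (λ j → 𝟙 (f (vtx t j) ≤? a))
        quantiles t = quantile (λ j → f (vtx t j)) H k k<m (λ j → f<H (vtx t j))

        F : Leaf L → ℕ
        F t = proj₁ (quantiles t)

        F<H : ∀ t → F t < H
        F<H t = proj₁ (proj₂ (quantiles t))

        W Z : Fin N → Set
        W w = w ∉ S × f w ≤ F (leaf w)
        Z v = v ∈ S ⊎ f v < F (leaf v) ⊎ ¬ Light v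

        W? : U.Decidable W
        W? w = ¬? (w ∈? S) ×-dec (f w ≤? F (leaf w))

        Z? : U.Decidable Z
        Z? v = (v ∈? S) ⊎-dec (f v <? F (leaf v)) ⊎-dec ¬? (Light? v)

        -- A late draw with a light target outside `S` would be an arrow to some `v` with f v < f w
        -- ≤ F (leaf w) ≤ F (leaf v), which puts `v` into `Z`.
        ¬late : ∀ w i → W w → ¬ Late Z F (leaf w) (g w i)
        ¬late w i (w∉S , fw≤) (usable , ¬z , le) = ¬z (inj₂ (inj₁ fv<))
          where
          v = target (leaf w) (g w i)
          light : Light v
          light = decidable-stable (Light? v) (¬z ∘ inj₂ ∘ inj₂)
          fv< : f v < F (leaf v)
          fv< = <-≤-trans (f-descends (light , i , usable , refl) w∉S (¬z ∘ inj₁))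
            (≤-trans fw≤ (≤-trans le (≤-reflexive (cong F (sym (leaf-vtx (goal (leaf w) (g w i)) (slot (source (g w i)))))))))

        active dense σ ζ : ℕ
        active = ∑ (λ w → 𝟙 (W? w ×-dec Dense? Z? F (leaf w)))
        dense  = ∑ᴸ (λ t → 𝟙 (Dense? Z? F t))
        σ      = ∑ (λ v → 𝟙 (v ∈? S))
        ζ      = ∑ (λ v → 𝟙 (Z? v))

        active-rare : 2 * (K * K) * active ≤ N
        active-rare = <⇒≤ (≰⇒> λ large → let w , i , w∈W , late = hits W? Z? F F<H large in ¬late w i w∈W late)

        -- By the choice of the quantile, more than m / K slots of a leaf satisfy f ≤ F. At a dense
        -- leaf each of them is active or in `S`.
        dense≤ : m * dense ≤ K * (active + σ)
        dense≤ = begin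
          m * dense
            ≡⟨ *-distribˡ-sum m (λ x → 𝟙 (Dense? Z? F (dec x))) ⟩
          ∑ᴸ (λ t → m * 𝟙 (Dense? Z? F t))
            ≤⟨ ∑-mono (λ x → perLeaf (dec x)) ⟩
          ∑ᴸ (λ t → K * ∑ (λ j → marks (vtx t j)))
            ≡⟨ *-distribˡ-sum K (λ x → ∑ (λ j → marks (vtx (dec x) j))) ⟨
          K * ∑ᴸ (λ t → ∑ (λ j → marks (vtx t j)))
            ≡⟨ cong (K *_) (∑-vtx marks) ⟨
          K * ∑ marks
            ≡⟨ cong (K *_) (∑-distrib-+ (λ w → 𝟙 (W? w ×-dec Dense? Z? F (leaf w))) (λ v → 𝟙 (v ∈? S))) ⟩
          K * (active + σ) ∎
          where
          open ≤-Reasoning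
          marks : Fin N → ℕ
          marks w = 𝟙 (W? w ×-dec Dense? Z? F (leaf w)) + 𝟙 (w ∈? S)
          perVertex : ∀ t j → 𝟙 (Dense? Z? F t) * 𝟙 (f (vtx t j) ≤? F t) ≤ marks (vtx t j)
          perVertex t j = ≤-trans
            (𝟙-× (Dense? Z? F t) (f v ≤? F t) (Dense? Z? F t ×-dec (f v ≤? F t)) _,_)
            (𝟙-⊎ (Dense? Z? F t ×-dec (f v ≤? F t)) (W? v ×-dec Dense? Z? F (leaf v)) (v ∈? S) sort)
            where
            v = vtx t j
            sort : Dense Z? F t × f v ≤ F t → (W v × Dense Z? F (leaf v)) ⊎ v ∈ S
            sort (dn , le) with v ∈? S
            ... | yes v∈S = inj₂ v∈S
            ... | no  v∉S = inj₁ ((v∉S , subst (λ t → f v ≤ F t) (sym (leaf-vtx t j)) le) , subst (Dense Z? F) (sym (leaf-vtx t j)) dn)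
          perLeaf : ∀ t → m * 𝟙 (Dense? Z? F t) ≤ K * ∑ (λ j → marks (vtx t j))
          perLeaf t = begin
            m * x                                           ≤⟨ *-monoˡ-≤ x (<⇒≤ (n<[1+n/q]*q m K)) ⟩
            suc k * K * x                                   ≤⟨ *-monoˡ-≤ x (*-monoˡ-≤ K (proj₂ (proj₂ (proj₂ (quantiles t))))) ⟩
            h * K * x                                       ≡⟨ reorder h K x ⟩
            K * (x * h)                                     ≡⟨ cong (K *_) (*-distribˡ-sum x (λ j → 𝟙 (f (vtx t j) ≤? F t))) ⟩
            K * ∑ (λ j → x * 𝟙 (f (vtx t j) ≤? F t))        ≤⟨ *-monoʳ-≤ K (∑-mono (perVertex t)) ⟩
            K * ∑ (λ j → marks (vtx t j))                   ∎
            where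
            x = 𝟙 (Dense? Z? F t)
            h = ∑ (λ j → 𝟙 (f (vtx t j) ≤? F t))
            reorder : ∀ h K x → h * K * x ≡ K * (x * h)
            reorder = solve-∀

        -- Active vertices and `S` each make up at most 1 / (2 K²) of all vertices. Passing from
        -- slots to leaves loses a factor K, which leaves a fraction 1 / K.
        dense-rare : K * dense ≤ T
        dense-rare = *-cancelʳ-≤ _ _ (2 * m) {{m*n≢0 2 m}} (begin
          K * dense * (2 * m)                              ≡⟨ e₁ K dense m ⟩
          2 * K * (m * dense)                              ≤⟨ *-monoʳ-≤ (2 * K) dense≤ ⟩
          2 * K * (K * (active + σ))                       ≡⟨ e₂ K active σ ⟩
          2 * (K * K) * active + 2 * (K * K) * σ           ≤⟨ +-mono-≤ active-rare (subst (λ s → 2 * (K * K) * s ≤ N) (∣S∣≡∑ S) small) ⟩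
          N + N                                            ≡⟨ e₃ T m ⟩
          T * (2 * m)                                      ∎)
          where
          open ≤-Reasoning
          e₁ : ∀ K d m → K * d * (2 * m) ≡ 2 * K * (m * d)
          e₁ = solve-∀
          e₂ : ∀ K a s → 2 * K * (K * (a + s)) ≡ 2 * (K * K) * a + 2 * (K * K) * s
          e₂ = solve-∀
          e₃ : ∀ T m → T * m + T * m ≡ T * (2 * m)
          e₃ = solve-∀

        -- A leaf that is not dense has fewer than Ω / K late draws, and the at most T / K dense
        -- leaves have at most Ω each.
        lates-rare : K * ∑ᴸ (lates Z? F) ≤ 2 * (T * Ω)
        lates-rare = begin
          K * ∑ᴸ (lates Z? F)                                  ≡⟨ *-distribˡ-sum K (λ x → lates Z? F (dec x)) ⟩
          ∑ᴸ (λ t → K * lates Z? F t)                          ≤⟨ ∑-mono (λ x → perLeaf (dec x)) ⟩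
          ∑ᴸ (λ t → Ω + 𝟙 (Dense? Z? F t) * (K * Ω))           ≡⟨ ∑-distrib-+ {T} (λ _ → Ω) (λ x → 𝟙 (Dense? Z? F (dec x)) * (K * Ω)) ⟩
          ∑ {T} (λ _ → Ω) + ∑ᴸ (λ t → 𝟙 (Dense? Z? F t) * (K * Ω))   ≡⟨ cong₂ _+_ (∑-const T Ω) (sym (*-distribʳ-sum (K * Ω) (λ x → 𝟙 (Dense? Z? F (dec x))))) ⟩
          T * Ω + dense * (K * Ω)                              ≡⟨ e₁ T Ω dense K ⟩
          T * Ω + K * dense * Ω                                ≤⟨ +-monoʳ-≤ (T * Ω) (*-monoˡ-≤ Ω dense-rare) ⟩
          T * Ω + T * Ω                                        ≡⟨ cong (T * Ω +_) (+-identityʳ (T * Ω)) ⟨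
          2 * (T * Ω)                                          ∎
          where
          open ≤-Reasoning
          e₁ : ∀ T Ω d K → T * Ω + d * (K * Ω) ≡ T * Ω + K * d * Ω
          e₁ = solve-∀
          lates≤Ω : ∀ t → lates Z? F t ≤ Ω
          lates≤Ω t = ≤-trans (∑-≤ {Ω} (λ ω → 𝟙≤1 (Late? Z? F t ω))) (≤-reflexive (*-identityʳ Ω))
          perLeaf : ∀ t → K * lates Z? F t ≤ Ω + 𝟙 (Dense? Z? F t) * (K * Ω)
          perLeaf t = by (Dense? Z? F t)
            where
            by : (p : Dec (Dense Z? F t)) → K * lates Z? F t ≤ Ω + 𝟙 p * (K * Ω)
            by (yes _) = ≤-trans (*-monoʳ-≤ K (lates≤Ω t)) (≤-trans (≤-reflexive (sym (*-identityˡ (K * Ω)))) (m≤n+m _ Ω))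
            by (no ¬p) = ≤-trans (<⇒≤ (≰⇒> ¬p)) (m≤m+n Ω _)

        -- `S`, the vertices below the quantile of their leaf and the heavy vertices each number at
        -- most N / K.
        ζ-small : K * ζ ≤ 3 * N
        ζ-small = begin
          K * ζ                             ≤⟨ *-monoʳ-≤ K split ⟩
          K * (σ + (b + h))                 ≡⟨ trans (*-distribˡ-+ K σ (b + h)) (cong (K * σ +_) (*-distribˡ-+ K b h)) ⟩
          K * σ + (K * b + K * h)           ≤⟨ +-mono-≤ Kσ≤ (+-mono-≤ Kb≤ heavy-rare) ⟩
          N + (N + N)                       ≡⟨ cong (λ x → N + (N + x)) (+-identityʳ N) ⟨
          3 * N                             ∎
          where
          open ≤-Reasoning
          b = ∑ (λ v → 𝟙 (f v <? F (leaf v)))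
          h = ∑ (λ v → 𝟙 (¬? (Light? v)))
          split : ζ ≤ σ + (b + h)
          split = ≤-trans
            (∑-mono λ v → ≤-trans
              (𝟙-⊎ (Z? v) (v ∈? S) ((f v <? F (leaf v)) ⊎-dec ¬? (Light? v)) id)
              (+-monoʳ-≤ (𝟙 (v ∈? S)) (𝟙-⊎ ((f v <? F (leaf v)) ⊎-dec ¬? (Light? v)) (f v <? F (leaf v)) (¬? (Light? v)) id)))
            (≤-reflexive (trans
              (∑-distrib-+ (λ v → 𝟙 (v ∈? S)) (λ v → 𝟙 (f v <? F (leaf v)) + 𝟙 (¬? (Light? v))))
              (cong (σ +_) (∑-distrib-+ (λ v → 𝟙 (f v <? F (leaf v))) (λ v → 𝟙 (¬? (Light? v)))))))
          Kσ≤ : K * σ ≤ N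
          Kσ≤ = ≤-trans (*-monoˡ-≤ σ (≤-trans (m≤m*n K (K + K)) (≤-reflexive (e K))))
                  (subst (λ s → 2 * (K * K) * s ≤ N) (∣S∣≡∑ S) small)
            where
            e : ∀ K → K * (K + K) ≡ 2 * (K * K)
            e = solve-∀
          Kb≤ : K * b ≤ N
          Kb≤ = begin
            K * b                                                  ≡⟨ cong (K *_) (∑-vtx (λ v → 𝟙 (f v <? F (leaf v)))) ⟩
            K * ∑ᴸ (λ t → ∑ (λ j → 𝟙 (f (vtx t j) <? F (leaf (vtx t j)))))
              ≤⟨ *-monoʳ-≤ K (∑-≤ {T} λ x → ≤-trans
                   (∑-mono λ j → 𝟙-mono (f (vtx (dec x) j) <? F (leaf (vtx (dec x) j))) (f (vtx (dec x) j) <? F (dec x))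
                     (subst (λ t → f (vtx (dec x) j) < F t) (leaf-vtx (dec x) j)))
                   (proj₁ (proj₂ (proj₂ (quantiles (dec x)))))) ⟩
            K * (T * k)                                            ≡⟨ e K T k ⟩
            T * (k * K)                                            ≤⟨ *-monoʳ-≤ T (m/n*n≤m m K) ⟩
            T * m                                                  ∎
            where
            e : ∀ K T k → K * (T * k) ≡ T * (k * K)
            e = solve-∀

        -- The factor m counts the slots, which turns violations into pairs of a leaf and a draw.
        -- Such a draw is late or leads into `Z`; by uniformity of the targets the latter happens L
        -- T ζ times at most.
        violations≤ : m * violations F ≤ L * (T * ζ) + ∑ᴸ (lates Z? F)
        violations≤ = begin
          m * violations F
            ≡⟨ *-distribˡ-sum m (λ s → ∑ᴸ (λ t → ∑ᴸ (λ u → v s t u))) ⟩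
          ∑ (λ s → m * ∑ᴸ (λ t → ∑ᴸ (λ u → v s t u)))
            ≡⟨ (∑-cong λ s → trans (*-distribˡ-sum m (λ x → ∑ᴸ (λ u → v s (dec x) u)))
                 (∑-cong λ x → trans (*-distribˡ-sum m (λ y → v s (dec x) (dec y)))
                   (∑-cong λ y → sym (∑-const m (v s (dec x) (dec y)))))) ⟩
          ∑ (λ s → ∑ᴸ (λ t → ∑ᴸ (λ u → ∑ {m} (λ j → v s t u))))
            ≡⟨ ∑-comm (λ s x → ∑ᴸ (λ u → ∑ {m} (λ j → v s (dec x) u))) ⟩
          ∑ᴸ (λ t → ∑ (λ s → ∑ᴸ (λ u → ∑ {m} (λ j → v s t u))))
            ≡⟨ (∑-cong λ x → sym (∑-draws (λ s u j → v s (dec x) u))) ⟩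
          ∑ᴸ (λ t → ∑ (λ ω → v (level ω) t (leaf (source ω))))
            ≤⟨ (∑-mono λ x → ∑-mono λ ω → 𝟙-⊎ (Violation? F (level ω) (dec x) (leaf (source ω)))
                  (Z? (target (dec x) ω)) (Late? Z? F (dec x) ω) (sort (dec x) ω)) ⟩
          ∑ᴸ (λ t → ∑ (λ ω → z (target t ω) + 𝟙 (Late? Z? F t ω)))
            ≡⟨ (∑-cong λ x → ∑-distrib-+ (λ ω → z (target (dec x) ω)) (λ ω → 𝟙 (Late? Z? F (dec x) ω))) ⟩
          ∑ᴸ (λ t → ∑ (λ ω → z (target t ω)) + lates Z? F t)
            ≡⟨ ∑-distrib-+ (λ x → ∑ (λ ω → z (target (dec x) ω))) (λ x → lates Z? F (dec x)) ⟩
          ∑ᴸ (λ t → ∑ (λ ω → z (target t ω))) + ∑ᴸ (lates Z? F)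
            ≡⟨ cong (_+ ∑ᴸ (lates Z? F)) targets ⟩
          L * (T * ζ) + ∑ᴸ (lates Z? F) ∎
          where
          open ≤-Reasoning
          v : Fin L → Leaf L → Leaf L → ℕ
          v s t u = 𝟙 (Violation? F s t u)
          z : Fin N → ℕ
          z x = 𝟙 (Z? x)
          sort : ∀ t ω → Violation F (level ω) t (leaf (source ω)) → Z (target t ω) ⊎ Late Z F t ω
          sort t ω (usable , le) with Z? (target t ω)
          ... | yes p = inj₁ p
          ... | no ¬p = inj₂ (usable , ¬p , le)
          targets : ∑ᴸ (λ t → ∑ (λ ω → z (target t ω))) ≡ L * (T * ζ)
          targets = begin-equality
            ∑ᴸ (λ t → ∑ (λ ω → z (target t ω)))
              ≡⟨ (∑-cong λ x → ∑-draws (λ s u j → z (vtx (mix s (dec x) u) j))) ⟩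
            ∑ᴸ (λ t → ∑ (λ s → ∑ᴸ (λ u → ∑ (λ j → z (vtx (mix s t u) j)))))
              ≡⟨ ∑-comm (λ x s → ∑ᴸ (λ u → ∑ (λ j → z (vtx (mix s (dec x) u) j)))) ⟩
            ∑ (λ s → ∑ᴸ (λ t → ∑ᴸ (λ u → ∑ (λ j → z (vtx (mix s t u) j)))))
              ≡⟨ (∑-cong λ s → trans (∑ᴸ-mix s (λ t → ∑ (λ j → z (vtx t j)))) (cong (T *_) (sym (∑-vtx z)))) ⟩
            ∑ {L} (λ s → T * ζ)
              ≡⟨ ∑-const L (T * ζ) ⟩
            L * (T * ζ) ∎

        -- `Z` contributes 3 L T² / K and the late draws 2 L T² / K. As 2560 = 5 · 512, the sum
        -- contradicts `violations-large`.
        violations-rare : 2560 ≤ K → 512 * violations F ≤ L * (T * T)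
        violations-rare 2560≤K = *-cancelˡ-≤ 5 (*-cancelʳ-≤ _ _ m (begin
          5 * (512 * violations F) * m                     ≡⟨ cong (_* m) (*-assoc 5 512 (violations F)) ⟨
          2560 * violations F * m                          ≤⟨ *-monoˡ-≤ m (*-monoˡ-≤ (violations F) 2560≤K) ⟩
          K * violations F * m                             ≡⟨ trans (*-assoc K (violations F) m) (cong (K *_) (*-comm (violations F) m)) ⟩
          K * (m * violations F)                           ≤⟨ *-monoʳ-≤ K violations≤ ⟩
          K * (L * (T * ζ) + ∑ᴸ (lates Z? F))              ≡⟨ e₁ K L T ζ (∑ᴸ (lates Z? F)) ⟩
          L * (T * (K * ζ)) + K * ∑ᴸ (lates Z? F)          ≤⟨ +-mono-≤ (*-monoʳ-≤ L (*-monoʳ-≤ T ζ-small)) lates-rare ⟩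
          L * (T * (3 * N)) + 2 * (T * Ω)                  ≡⟨ e₂ L T m ⟩
          5 * (L * (T * T)) * m                            ∎))
          where
          open ≤-Reasoning
          e₁ : ∀ K L T z y → K * (L * (T * z) + y) ≡ L * (T * (K * z)) + K * y
          e₁ = solve-∀
          e₂ : ∀ L T m → L * (T * (3 * (T * m))) + 2 * (T * (L * (T * m))) ≡ 5 * (L * (T * T)) * m
          e₂ = solve-∀

open Combinatorics using (module Random; module Network; violations-large)
open import Data.Fin.Subset using (Subset; _⊂_; ⊤; ∣_∣)
open import Data.Integer as ℤ using (+_; +[1+_])
import Data.Integer.Properties as ℤ
open import Data.Nat as ℕ using (ℕ; zero; suc; NonZero; z≤n; s≤s; _≤_; _<_; _+_; _*_)
open import Data.Nat.Coprimality using (1-coprimeTo) renaming (sym to coprime-sym)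
import Data.Nat.Properties as ℕ
open import Data.Nat.Tactic.RingSolver using (solve-∀)
open import Data.Product using (∃-syntax; _×_; _,_)
open import Data.Rational as ℚ using (ℚ; mkℚ; 0ℚ; 1ℚ; _/_; ↥_; ↧ₙ_)
import Data.Rational.Properties as ℚ
import Data.Rational.Unnormalised.Properties as ℚᵘ
import Data.Rational.Unnormalised as ℚᵘ
open import Data.Unit using (tt)
open import Defs
open import Relation.Binary.PropositionalEquality
open import Relation.Nullary.Decidable using (toWitness)

-- The codepth bound for a single network.

module Level (κ : ℕ) .{{κ≢0 : NonZero κ}} (2560≤K : 2560 ≤ suc κ) (ℓ : ℕ) .{{ℓ≢0 : NonZero ℓ}} where

  private instance
    L≢0 : NonZero (52 * ℓ)
    L≢0 = ℕ.m*n≢0 52 ℓ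
    m≢0 : NonZero (2 * ℓ)
    m≢0 = ℕ.m*n≢0 2 ℓ

  open Random (52 * ℓ) (2 * ℓ) κ public using (K; D; g; g-hits)
  open Network (52 * ℓ) (2 * ℓ) κ
  open WithDraws g public using (graph; dag; inDegree≤; outDegree≤)
  open WithDraws g using (module Descent; module Levels)
  open Graph graph using (∣V∣)

  codepth-large : (S : Subset ∣V∣) (S⊂V : S ⊂ ⊤) → 2 * (K * K) * ∣ S ∣ ≤ ∣V∣ → 2 ℕ.^ (2 * ℓ) ≤ codepth graph S S⊂V
  -- If the codepth were below 2 ^ m, then so would be `f`, and the two bounds on the violations of
  -- `F` would clash.
  codepth-large S S⊂V small = ℕ.≮⇒≥ λ shallow →
    let open Descent S⊂V
        open Levels g-hits S small f (λ v → ℕ.≤-<-trans (f≤d v) shallow) f-descends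
    in ℕ.<⇒≱ (violations-large ℓ F F<H) (violations-rare 2560≤K)

  n≤2^n : ∀ n → n ≤ 2 ℕ.^ n
  n≤2^n zero    = z≤n
  n≤2^n (suc n) = ℕ.+-mono-≤ (ℕ.m^n>0 2 n) (ℕ.≤-trans (n≤2^n n) (ℕ.≤-reflexive (sym (ℕ.+-identityʳ _))))

  -- The slots number at most 2 ^ L, hence |V| ≤ 2 ^ (104 ℓ). So the codepth bound 2 ^ (2 ℓ) is at
  -- least |V| ^ (1 / 52).
  ∣V∣≤ : ∣V∣ ≤ (2 ℕ.^ (2 * ℓ)) ℕ.^ 52
  ∣V∣≤ = begin
    2 ℕ.^ (52 * ℓ) * (2 * ℓ)              ≤⟨ ℕ.*-monoʳ-≤ (2 ℕ.^ (52 * ℓ)) (ℕ.≤-trans (ℕ.*-monoˡ-≤ ℓ (s≤s (s≤s (z≤n {50})))) (n≤2^n (52 * ℓ))) ⟩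
    2 ℕ.^ (52 * ℓ) * 2 ℕ.^ (52 * ℓ)       ≡⟨ ℕ.^-distribˡ-+-* 2 (52 * ℓ) (52 * ℓ) ⟨
    2 ℕ.^ (52 * ℓ + 52 * ℓ)               ≡⟨ cong (2 ℕ.^_) (e ℓ) ⟩
    2 ℕ.^ (2 * ℓ * 52)                    ≡⟨ ℕ.^-*-assoc 2 (2 * ℓ) 52 ⟨
    (2 ℕ.^ (2 * ℓ)) ℕ.^ 52                ∎
    where
    open ℕ.≤-Reasoning
    e : ∀ ℓ → 52 * ℓ + 52 * ℓ ≡ 2 * ℓ * 52
    e = solve-∀

-- Translation to rationals and cuts.

ι : ℕ → ℚ
ι n = + n / 1

ι-mkℚ : ∀ n → ι n ≡ mkℚ (+ n) 0 (coprime-sym (1-coprimeTo n))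
ι-mkℚ n = ℚ.↥p/↧p≡p (mkℚ (+ n) 0 (coprime-sym (1-coprimeTo n)))

ι-mono-≤ : ∀ {m n} → m ≤ n → ι m ℚ.≤ ι n
ι-mono-≤ {m} {n} m≤n = subst₂ ℚ._≤_ (sym (ι-mkℚ m)) (sym (ι-mkℚ n))
  (ℚ.*≤* (ℤ.*-monoʳ-≤-nonNeg (+ 1) (ℤ.+≤+ m≤n)))

ι-mono-< : ∀ {m n} → m < n → ι m ℚ.< ι n
ι-mono-< {m} {n} m<n = subst₂ ℚ._<_ (sym (ι-mkℚ m)) (sym (ι-mkℚ n))
  (ℚ.*<* (ℤ.*-monoʳ-<-pos (+ 1) (ℤ.+<+ m<n)))

ι-* : ∀ m n → ι (m * n) ≡ ι m ℚ.* ι n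
ι-* m n rewrite ι-mkℚ m | ι-mkℚ n | ι-mkℚ (m * n) = ℚ.toℚᵘ-injective
  (ℚᵘ.≃-trans (ℚᵘ.*≡* (cong (ℤ._* + 1) (ℤ.pos-* m n)))
    (ℚᵘ.≃-sym (ℚ.toℚᵘ-homo-* (mkℚ (+ m) 0 (coprime-sym (1-coprimeTo m))) (mkℚ (+ n) 0 (coprime-sym (1-coprimeTo n))))))

ι-^ : ∀ m k → ι (m ℕ.^ k) ≡ ι m ^ k
ι-^ m zero    = refl
ι-^ m (suc k) = trans (ι-* m (m ℕ.^ k)) (cong (ι m ℚ.*_) (ι-^ m k))

1/1+ : ℕ → ℚ
1/1+ n = mkℚ +[1+ 0 ] n (1-coprimeTo (suc n))

1/1+-* : ∀ n → 1/1+ n ℚ.* ι (suc n) ≡ 1ℚ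
1/1+-* n rewrite ι-mkℚ (suc n) = ℚ.*-inverseʳ (1/1+ n)

<1/1+ : ∀ s n → 0ℚ ℚ.< s → s ℚ.< 1/1+ n → suc n * ℤ.∣ ↥ s ∣ ≤ ↧ₙ s
<1/1+ s@(mkℚ +[1+ a ] d _) n 0<s (ℚ.*<* lt) = ℕ.<⇒≤ (ℤ.drop‿+<+ (subst₂ ℤ._<_ (cong +_ (ℕ.*-comm (suc a) (suc n))) (cong +_ (ℕ.+-identityʳ (suc d))) lt))
<1/1+ (mkℚ (+ 0) d _) n 0<s lt = ℕ.≤-trans (ℕ.≤-reflexive (ℕ.*-zeroʳ (suc n))) z≤n
<1/1+ (mkℚ ℤ.-[1+ a ] d _) n (ℚ.*<* ()) lt

-- By hypothesis all positive rationals below `s` lie in the cut of ε N. If N < (1 + n) s, then ε N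
-- itself is among them, but every member of the cut is strictly smaller.
ε-bound : ∀ n {s N} .{{_ : NonZero N}} → (ι s) ℚ≤ℝ (fromℚ (1/1+ n) *ℝ fromℕ N) → suc n * s ≤ N
ε-bound n {s} {N} s≤ = ℕ.≮⇒≥ λ N<ns →
  let _ , a , b , (0<a , a<ε) , (0<b , b<N) , p<ab = s≤ (*-pos 0<ε (0<n/1 N)) (p<s N<ns)
  in ℚ.<-irrefl refl (ℚ.<-trans p<ab (*-mono-< 0<ε 0<b a<ε b<N))
  where
  0<ε : 0ℚ ℚ.< 1/1+ n
  0<ε = ℚ.positive⁻¹ (1/1+ n)
  p<s : N < suc n * s → 1/1+ n ℚ.* ι N ℚ.< ι s
  p<s lt = subst (1/1+ n ℚ.* ι N ℚ.<_) (begin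
    1/1+ n ℚ.* ι (suc n * s)              ≡⟨ cong (1/1+ n ℚ.*_) (ι-* (suc n) s) ⟩
    1/1+ n ℚ.* (ι (suc n) ℚ.* ι s)        ≡⟨ ℚ.*-assoc (1/1+ n) (ι (suc n)) (ι s) ⟨
    1/1+ n ℚ.* ι (suc n) ℚ.* ι s          ≡⟨ cong (ℚ._* ι s) (1/1+-* n) ⟩
    1ℚ ℚ.* ι s                            ≡⟨ ℚ.*-identityˡ (ι s) ⟩
    ι s                                   ∎)
    (ℚ.*-monoʳ-<-pos (1/1+ n) (ι-mono-< lt))
    where open ≡-Reasoning

-- If X ≤ b, then a rational exponent s < 1 / (1 + d) witnessing that `b` is in the cut gives b < N
-- ^ s ≤ X ^ ((1 + d) s) ≤ X.
^ℝ-bound : ∀ d {N X b} .{{_ : NonZero N}} .{{_ : NonZero X}} → N ≤ X ℕ.^ suc d →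
           b ∈ℝ N ^ℝ fromℚ (1/1+ d) → b ℚ.< ι X
^ℝ-bound d {N} {X} {b} N≤ (0<b , s , (0<s , s<δ) , bᵈ<Nˢ) = ℚ.≰⇒> λ X≤b → ℚ.<-irrefl refl (begin-strict
  ι X ^ (↧ₙ s)                       ≤⟨ ^-monoˡ-≤ (↧ₙ s) (0<n/1 X) X≤b ⟩
  b ^ (↧ₙ s)                         <⟨ bᵈ<Nˢ ⟩
  ι N ^ ℤ.∣ ↥ s ∣                    ≤⟨ ^-monoˡ-≤ ℤ.∣ ↥ s ∣ (0<n/1 N) (ι-mono-≤ N≤) ⟩
  ι (X ℕ.^ suc d) ^ ℤ.∣ ↥ s ∣        ≡⟨ cong (_^ ℤ.∣ ↥ s ∣) (ι-^ X (suc d)) ⟩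
  (ι X ^ suc d) ^ ℤ.∣ ↥ s ∣          ≡⟨ ^-assocʳ (ι X) (suc d) ℤ.∣ ↥ s ∣ ⟩
  ι X ^ (suc d * ℤ.∣ ↥ s ∣)          ≤⟨ ^-monoʳ-≤ (1≤n/1 X) (<1/1+ s d 0<s s<δ) ⟩
  ι X ^ (↧ₙ s)                       ∎)
  where open ℚ.≤-Reasoning

^ℝ-unbounded : ∀ d M → ∃[ N ] ∀ n .{{_ : NonZero n}} → N ≤ n → ι M ℚ≤ℝ n ^ℝ fromℚ (1/1+ d)
-- The exponent 1 / (d + 2) lies below 1 / (d + 1), so n > M ^ (d + 2) suffices.
^ℝ-unbounded d M = suc (M ℕ.^ suc (suc d)) , λ n M^<n {p} 0<p p<M →
  0<p , 1/1+ (suc d) , (ℚ.positive⁻¹ (1/1+ (suc d)) , ℚ.*<* (ℤ.+<+ (s≤s (s≤s (ℕ.≤-reflexive refl))))) , (begin-strict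
    p ^ suc (suc d)             ≤⟨ ^-monoˡ-≤ (suc (suc d)) 0<p (ℚ.<⇒≤ p<M) ⟩
    ι M ^ suc (suc d)           ≡⟨ ι-^ M (suc (suc d)) ⟨
    ι (M ℕ.^ suc (suc d))       <⟨ ι-mono-< M^<n ⟩
    ι n                         ≡⟨ ℚ.*-identityʳ (ι n) ⟨
    ι n ^ 1                     ∎)
  where open ℚ.≤-Reasoning

-- The extender sequence.

module Family (κ : ℕ) .{{κ≢0 : NonZero κ}} (2560≤K : 2560 ≤ suc κ) where

  module At (n : ℕ) = Level κ 2560≤K (suc n)

  G : ℕ → DAG
  G n = At.dag n

  K D : ℕ
  K = suc κ
  D = 8 * (K * K * K)

  δ : ℝ⁺
  -- δ = 1 / 52 = 0.01923...
  δ = fromℚ (1/1+ 51)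

  boundedDegrees : BoundedDegrees G
  boundedDegrees = K * D + D , λ n v → ℕ.+-mono-≤ (At.inDegree≤ n v) (At.outDegree≤ n v)

  extenders : IsExtenderSequence (λ n → n ^ℝ δ) G
  extenders = record
    { ρ→∞              = ^ℝ-unbounded 51
    ; boundedInDegrees = K * D , λ n → At.inDegree≤ n
    ; ∣V∣→∞            = λ M → M , λ n M≤n → ℕ.≤-trans M≤n (ℕ.≤-trans (ℕ.n≤1+n n)
        (ℕ.≤-trans (ℕ.m≤n*m (suc n) 2) (ℕ.m≤n*m (2 * suc n) (2 ℕ.^ (52 * suc n)) {{ℕ.m^n≢0 2 (52 * suc n)}})))
    -- ε = 1 / (2 K²) is the density of `S` allowed by `codepth-large`, and C = 1; `pred` offsets
    -- the successor in `1/1+`.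
    ; extender         = fromℚ (1/1+ (ℕ.pred (2 * (K * K)))) , fromℚ 1ℚ , extend
    }
    where
    extend : ∀ n → let open DAG (G n) in IsExtender (fromℚ (1/1+ (ℕ.pred (2 * (K * K))))) (fromℚ 1ℚ *ℝ (_^ℝ_ ∣V∣ {{nonEmpty}} δ)) (G n)
    extend n S S⊂V small {p} (0<p , a , b , (0<a , a<1) , b∈@(0<b , _) , p<ab) = ℚ.<⇒≤ (begin-strict
      p                                ≤⟨ ℚ.<⇒≤ p<ab ⟩
      a ℚ.* b                          ≤⟨ ℚ.*-monoʳ-≤-nonNeg b {{ℚ.nonNegative (ℚ.<⇒≤ 0<b)}} (ℚ.<⇒≤ a<1) ⟩
      1ℚ ℚ.* b                         ≡⟨ ℚ.*-identityˡ b ⟩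
      b                                <⟨ ^ℝ-bound 51 {{DAG.nonEmpty (G n)}} {{ℕ.m^n≢0 2 (2 * suc n)}} (At.∣V∣≤ n) b∈ ⟩
      ι (2 ℕ.^ (2 * suc n))            ≤⟨ ι-mono-≤ (At.codepth-large n S S⊂V (ε-bound (ℕ.pred (2 * (K * K))) {{DAG.nonEmpty (G n)}} small)) ⟩
      ι (codepth (DAG.graph (G n)) S S⊂V)   ∎)
      where open ℚ.≤-Reasoning

  δ≈0·019 : δ ≈0·019
  δ≈0·019 =
      (λ 0<p p< → 0<p , ℚ.<-trans p< (toWitness {a? = (+ 37 / 2000) ℚ.<? 1/1+ 51} tt))
    , (λ (_ , p<δ) → ℚ.<⇒≤ (ℚ.<-trans p<δ (toWitness {a? = 1/1+ 51 ℚ.<? (+ 39 / 2000)} tt)))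

theorem5 : ∃[ δ ] δ ≈0·019 × (∃[ G ] BoundedDegrees G × IsExtenderSequence (λ n → n ^ℝ δ) G)
theorem5 = δ , δ≈0·019 , G , boundedDegrees , extenders
  -- The least κ with 2560 ≤ 1 + κ.
  where open Family 2559 ℕ.≤-refl
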